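{- Let $A,B$ be multiplicative characters of $\mathbb{F}_q^\times$ ($q$ odd) such that $B$, $B^2\overline{A}$, $A\overline{B}\phi$ are all nontrivial. Then for $z\in\mathbb{F}_q$ with $z\neq\pm1$, $${}_2\mathbb{F}_1\!\left(A,B;B^2;\tfrac{4z}{(1+z)^2}\right)=A^2(1+z)\,{}_2\mathbb{F}_1(A,A\phi\overline{B};B\phi;z^2).$$
   Context: Multiplicative characters of $\mathbb{F}_q^\times$ are extended to $\mathbb{F}_q$ by $\chi(0)=0$, including the trivial character. $\phi$ is the quadratic character, $\overline{A}=A^{ -1}$, products of characters are pointwise. $J(A,B)=\sum_{t\in\mathbb{F}_q}A(t)B(1-t)$. ${}_2\mathbb{P}_1(A,B;C;\lambda)=\sum_{y\in\mathbb{F}_q}B(y)\,\overline{B}C(1-y)\,\overline{A}(1-\lambda y)$ and ${}_2\mathbb{F}_1(A,B;C;\lambda)={}_2\mathbb{P}_1(A,B;C;\lambda)/J(B,\overline{B}C)$. -}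

module Defs where

open import Level using (Level; _⊔_) renaming (suc to lsuc)
open import Data.Nat as ℕ using (ℕ; zero; suc; _%_)
open import Data.List using (List; foldr; length)
open import Data.List.Relation.Unary.Any using (Any; any?)
open import Data.List.Relation.Unary.AllPairs using (AllPairs)
open import Data.Product using (Σ; _×_; _,_)
open import Relation.Nullary using (¬_; Dec; yes; no)
open import Relation.Binary.Definitions using (Decidable)
open import Relation.Binary.PropositionalEquality using (_≡_)
open import Algebra.Bundles using (CommutativeRing)

record Field (c ℓ : Level) : Set (lsuc (c ⊔ ℓ)) where
  field
    commutativeRing : CommutativeRing c ℓ
  open CommutativeRing commutativeRing public
  field
    _⁻¹       : Carrier → Carrier
    ⁻¹-cong   : ∀ {x y} → x ≈ y → x ⁻¹ ≈ y ⁻¹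
    inverseʳ  : ∀ x → ¬ (x ≈ 0#) → x * (x ⁻¹) ≈ 1#
    0⁻¹≈0     : 0# ⁻¹ ≈ 0#
    1≉0       : ¬ (1# ≈ 0#)

  infix 8 _⁻¹

  natCast : ℕ → Carrier
  natCast zero    = 0#
  natCast (suc n) = 1# + natCast n

CharZero : ∀ {c ℓ} → Field c ℓ → Set ℓ
CharZero K = ∀ n → natCast n ≈ 0# → n ≡ 0
  where open Field K

record FiniteField (c ℓ : Level) : Set (lsuc (c ⊔ ℓ)) where
  field
    field′   : Field c ℓ
  open Field field′ public
  field
    _≟_      : Decidable _≈_
    elements : List Carrier
    complete : ∀ x → Any (x ≈_) elements
    distinct : AllPairs (λ a b → ¬ (a ≈ b)) elements

  q : ℕ
  q = length elements

module _ {c ℓ c′ ℓ′ : Level} (F : FiniteField c ℓ) (K : Field c′ ℓ′) where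
  private
    module F = FiniteField F
    module K = Field K

  record Character : Set (c ⊔ ℓ ⊔ c′ ⊔ ℓ′) where
    field
      χ      : F.Carrier → K.Carrier
      χ-cong : ∀ {x y} → x F.≈ y → χ x K.≈ χ y
      χ-0    : χ F.0# K.≈ K.0#
      χ-1    : χ F.1# K.≈ K.1#
      χ-*    : ∀ x y → χ (x F.* y) K.≈ χ x K.* χ y

  -- Functions F → K (characters are used through their underlying functions;
  -- products of characters are pointwise).
  Fn : Set (c ⊔ c′)
  Fn = F.Carrier → K.Carrier

  infixl 7 _·_
  _·_ : Fn → Fn → Fn
  (f · g) x = f x K.* g x

  -- conjugate character  Ā = A⁻¹ (pointwise; Ā(0) = 0⁻¹ = 0)
  conj : Fn → Fn
  conj f x = (f x) K.⁻¹

  trivial : Fn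
  trivial x with x F.≟ F.0#
  ... | yes _ = K.0#
  ... | no  _ = K.1#

  Nontrivial : Fn → Set (c ⊔ ℓ′)
  Nontrivial f = ¬ (∀ x → f x K.≈ trivial x)

  φ : Fn
  φ x with x F.≟ F.0#
  ... | yes _ = K.0#
  ... | no  _ with any? (λ y → (y F.* y) F.≟ x) F.elements
  ...   | yes _ = K.1#
  ...   | no  _ = K.- K.1#

  ΣF : Fn → K.Carrier
  ΣF f = foldr (λ x acc → f x K.+ acc) K.0# F.elements

  J : Fn → Fn → K.Carrier
  J A B = ΣF (λ t → A t K.* B (F.1# F.- t))

  P₂₁ : Fn → Fn → Fn → F.Carrier → K.Carrier
  P₂₁ A B C λ′ = ΣF (λ y → B y K.* (conj B · C) (F.1# F.- y)
                               K.* conj A (F.1# F.- λ′ F.* y))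

  F₂₁ : Fn → Fn → Fn → F.Carrier → K.Carrier
  F₂₁ A B C λ′ = P₂₁ A B C λ′ K.* (J B (conj B · C)) K.⁻¹

{-# OPTIONS --safe #-}
module Submission where

-- Put w = z², X = B²Ā, Y = AφB̄.  Clearing the Jacobi sums J(B,B) and J(Y,X), which are nonzero, the claim
-- becomes a proportionality between Σ_y B(y)B(1-y)Ā((1+z)²-4zy) and Σ_y Y(y)X(1-y)Ā(1-wy).  The substitution
-- v = (1-w)²/((1+z)²-4zy) turns the first sum into Σ_v X̄(v)B(Q(v)) with Q(v) = 2(1+w)v - v² - (1-w)².
-- Expanding X̄(v)J(Y,X) as a convolution of B̄φ and Y produces, for v = r + s, inner sums
-- Σ_s φ(s)B(β - s - n/s) with n = -Q(r).  Put T = s + n/s: if n = e² then φ(s) = φ(T ± 2e), while if n is not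
-- a square the involution s ↦ n/s cancels the sum; so each inner sum is J(φ,B) Σ_{e² = n} (φB)(β + 2e).
-- What is left is a sum over the points (r, e) of the conic e² = -Q(r), and the parametrisation
-- D = (β + 2e)/4 = w(1-y)/(1-wy) identifies it with the second sum.

open import Defs
open import Level using (Level; _⊔_)
open import Algebra.Bundles using (CommutativeRing)
open import Algebra.Bundles.Raw using (RawRing)
open import Algebra.Solver.Ring.AlmostCommutativeRing using (fromCommutativeRing; _-Raw-AlmostCommutative⟶_)
import Algebra.Properties.Ring as RingProperties
import Algebra.Properties.Semiring.Mult.TCOptimised as SemiringMult
import Algebra.Solver.Ring as RingSolver
open import Data.Integer as ℤ using (ℤ; +_; -[1+_])
import Data.Integer.Properties as ℤ
open import Data.Nat as ℕ using (ℕ; zero; suc; _%_)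
import Data.Nat.Properties as ℕ
open import Data.Maybe using (Maybe; just; nothing)
open import Data.List using (List; []; _∷_; foldr; length)
open import Data.List.Relation.Unary.Any as Any using (Any; here; there; any?)
open import Data.List.Relation.Unary.All as All using (All; []; _∷_)
open import Data.List.Relation.Unary.AllPairs using (AllPairs; []; _∷_)
open import Data.Product using (Σ; _×_; _,_; proj₁; proj₂)
open import Data.Sum using (_⊎_; inj₁; inj₂)
open import Data.Empty using (⊥)
open import Relation.Nullary using (¬_; Dec; yes; no; contradiction)
open import Relation.Nullary.Decidable using (_×-dec_; ¬?)
open import Relation.Binary.PropositionalEquality as ≡ using (_≡_)
import Relation.Binary.Reasoning.Setoid as SetoidReasoning

-- The field K is an arbitrary field of characteristic 0. It need not contain the roots of unity
-- behind Gauss sums or Fourier analysis over all characters, it carries no complex conjugation, and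
-- its equality comes without a decision procedure. So only the given characters and φ occur, sums
-- are transformed by substitution and exchange of summation, and nonvanishing is derived from
-- polynomial identities between sums together with counting in characteristic 0. The pair B̄φ, Y is
-- dictated by Q(r + s) = βs - s² - n with β = 2(1+w) - 2r: the factor B̄(s) divides this by s, and
-- the remaining φ(s) is what can be summed in closed form over the fibres of s + n/s. The
-- complementary factor must then be Y, because YX = Bφ. The condition z ≠ -1 makes 1 + z
-- invertible, and both conditions together do the same for 1 - w. The substitutions also divide by
-- z, so z = 0 is a separate case.

module IntegerSolver {c ℓ} (R : CommutativeRing c ℓ) where
  open CommutativeRing R
  open RingProperties ring using (-‿involutive; -0#≈0#; -‿distribˡ-*; -‿distribʳ-*; -‿+-comm)
  open SemiringMult semiring using (1+×; ×-homo-+; ×1-homo-*) renaming (_×_ to _×′_)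
  open SetoidReasoning setoid

  -- The ring solver has to compare coefficients. Integer coefficients have decidable equality,
  -- which the carrier of K does not, and they are mapped into the ring by this homomorphism.
  fromℤ : ℤ → Carrier
  fromℤ (+ n)    = n ×′ 1#
  fromℤ -[1+ n ] = - (suc n ×′ 1#)

  fromℤ-neg : ∀ i → fromℤ (ℤ.- i) ≈ - fromℤ i
  fromℤ-neg (+ zero)   = sym -0#≈0#
  fromℤ-neg (+ suc n)  = refl
  fromℤ-neg (-[1+ n ]) = sym (-‿involutive _)

  fromℤ-⊖ : ∀ m n → fromℤ (m ℤ.⊖ n) ≈ m ×′ 1# - n ×′ 1#
  fromℤ-⊖ m       zero    = sym (trans (+-congˡ -0#≈0#) (+-identityʳ _))
  fromℤ-⊖ zero    (suc n) = sym (+-identityˡ _)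
  fromℤ-⊖ (suc m) (suc n) = begin
    fromℤ (suc m ℤ.⊖ suc n)                    ≡⟨ ≡.cong fromℤ (ℤ.[1+m]⊖[1+n]≡m⊖n m n) ⟩
    fromℤ (m ℤ.⊖ n)                            ≈⟨ fromℤ-⊖ m n ⟩
    m ×′ 1# - n ×′ 1#                            ≈⟨ +-identityˡ _ ⟨
    0# + (m ×′ 1# - n ×′ 1#)                     ≈⟨ +-congʳ (-‿inverseʳ 1#) ⟨
    (1# - 1#) + (m ×′ 1# - n ×′ 1#)              ≈⟨ +-assoc _ _ _ ⟩
    1# + (- 1# + (m ×′ 1# - n ×′ 1#))            ≈⟨ +-congˡ (+-assoc _ _ _) ⟨
    1# + ((- 1# + m ×′ 1#) - n ×′ 1#)            ≈⟨ +-congˡ (+-congʳ (+-comm _ _)) ⟩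
    1# + ((m ×′ 1# - 1#) - n ×′ 1#)              ≈⟨ +-congˡ (+-assoc _ _ _) ⟩
    1# + (m ×′ 1# + (- 1# - n ×′ 1#))            ≈⟨ +-assoc _ _ _ ⟨
    (1# + m ×′ 1#) + (- 1# - n ×′ 1#)            ≈⟨ +-congˡ (-‿+-comm _ _) ⟩
    (1# + m ×′ 1#) - (1# + n ×′ 1#)              ≈⟨ +-cong (1+× m 1#) (-‿cong (1+× n 1#)) ⟨
    suc m ×′ 1# - suc n ×′ 1#                    ∎

  fromℤ-+ : ∀ i j → fromℤ (i ℤ.+ j) ≈ fromℤ i + fromℤ j
  fromℤ-+ (+ m)    (+ n)    = ×-homo-+ 1# m n
  fromℤ-+ (+ m)    -[1+ n ] = fromℤ-⊖ m (suc n)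
  fromℤ-+ -[1+ m ] (+ n)    = trans (fromℤ-⊖ n (suc m)) (+-comm _ _)
  fromℤ-+ -[1+ m ] -[1+ n ] = begin
    - (suc (suc (m ℕ.+ n)) ×′ 1#)   ≡⟨ ≡.cong (λ k → - (suc k ×′ 1#)) (ℕ.+-suc m n) ⟨
    - ((suc m ℕ.+ suc n) ×′ 1#)     ≈⟨ -‿cong (×-homo-+ 1# (suc m) (suc n)) ⟩
    - (suc m ×′ 1# + suc n ×′ 1#)    ≈⟨ -‿+-comm _ _ ⟨
    - (suc m ×′ 1#) - suc n ×′ 1#    ∎

  fromℤ-* : ∀ i j → fromℤ (i ℤ.* j) ≈ fromℤ i * fromℤ j
  fromℤ-* i (+ n) = go i
    where
    pos : ∀ m → fromℤ (+ m ℤ.* + n) ≈ m ×′ 1# * n ×′ 1#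
    pos m = trans (reflexive (≡.cong fromℤ (≡.sym (ℤ.pos-* m n)))) (×1-homo-* m n)
    go : ∀ i → fromℤ (i ℤ.* + n) ≈ fromℤ i * n ×′ 1#
    go (+ m)    = pos m
    go -[1+ m ] = begin
      fromℤ (-[1+ m ] ℤ.* + n)         ≡⟨ ≡.cong fromℤ (ℤ.neg-distribˡ-* (+ suc m) (+ n)) ⟨
      fromℤ (ℤ.- (+ suc m ℤ.* + n))    ≈⟨ fromℤ-neg (+ suc m ℤ.* + n) ⟩
      - fromℤ (+ suc m ℤ.* + n)        ≈⟨ -‿cong (pos (suc m)) ⟩
      - (suc m ×′ 1# * n ×′ 1#)          ≈⟨ -‿distribˡ-* _ _ ⟩
      - (suc m ×′ 1#) * n ×′ 1#          ∎
  fromℤ-* i -[1+ n ] = begin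
    fromℤ (i ℤ.* -[1+ n ])           ≡⟨ ≡.cong fromℤ (ℤ.neg-distribʳ-* i (+ suc n)) ⟨
    fromℤ (ℤ.- (i ℤ.* + suc n))      ≈⟨ fromℤ-neg (i ℤ.* + suc n) ⟩
    - fromℤ (i ℤ.* + suc n)          ≈⟨ -‿cong (fromℤ-* i (+ suc n)) ⟩
    - (fromℤ i * suc n ×′ 1#)         ≈⟨ -‿distribʳ-* _ _ ⟩
    fromℤ i * - (suc n ×′ 1#)         ∎

  private
    ℤ-rawRing : RawRing _ _
    ℤ-rawRing = record
      { Carrier = ℤ ; _≈_ = _≡_ ; _+_ = ℤ._+_ ; _*_ = ℤ._*_ ; -_ = ℤ.-_ ; 0# = + 0 ; 1# = + 1 }

    fromℤ-homomorphism : ℤ-rawRing -Raw-AlmostCommutative⟶ fromCommutativeRing R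
    fromℤ-homomorphism = record
      { ⟦_⟧ = fromℤ ; +-homo = fromℤ-+ ; *-homo = fromℤ-* ; -‿homo = fromℤ-neg
      ; 0-homo = refl ; 1-homo = refl }

    _coeff≟_ : ∀ i j → Maybe (fromℤ i ≈ fromℤ j)
    i coeff≟ j with i ℤ.≟ j
    ... | yes i≡j = just (reflexive (≡.cong fromℤ i≡j))
    ... | no _    = nothing

  open RingSolver ℤ-rawRing (fromCommutativeRing R) fromℤ-homomorphism _coeff≟_ public
    using (solve; _:+_; _:*_; _:-_; :-_; _:=_; con)

-- Arithmetic in a field whose inverse is total.

module FieldProperties {c ℓ} (K : Field c ℓ) where
  open Field K
  open IntegerSolver commutativeRing
  open SetoidReasoning setoid

  inverseˡ : ∀ x → ¬ (x ≈ 0#) → x ⁻¹ * x ≈ 1#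
  inverseˡ x x≉0 = trans (*-comm _ _) (inverseʳ x x≉0)

  *-cancelˡ : ∀ x {y z} → ¬ (x ≈ 0#) → x * y ≈ x * z → y ≈ z
  *-cancelˡ x {y} {z} x≉0 xy≈xz = begin
    y              ≈⟨ expand y ⟩
    x ⁻¹ * (x * y) ≈⟨ *-congˡ xy≈xz ⟩
    x ⁻¹ * (x * z) ≈⟨ expand z ⟨
    z              ∎
    where
    expand : ∀ y → y ≈ x ⁻¹ * (x * y)
    expand y = trans (sym (*-identityˡ y)) (trans (*-congʳ (sym (inverseˡ x x≉0))) (*-assoc _ _ _))

  *-zero-cancelˡ : ∀ x {y} → ¬ (x ≈ 0#) → x * y ≈ 0# → y ≈ 0#
  *-zero-cancelˡ x x≉0 xy≈0 = *-cancelˡ x x≉0 (trans xy≈0 (sym (zeroʳ x)))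

  *-nonzero : ∀ {x y} → ¬ (x ≈ 0#) → ¬ (y ≈ 0#) → ¬ (x * y ≈ 0#)
  *-nonzero x≉0 y≉0 xy≈0 = y≉0 (*-zero-cancelˡ _ x≉0 xy≈0)

  unit-nonzero : ∀ {x} y → x * y ≈ 1# → ¬ (x ≈ 0#)
  unit-nonzero y xy≈1 x≈0 = 1≉0 (trans (sym xy≈1) (trans (*-congʳ x≈0) (zeroˡ y)))

  inverse-nonzero : ∀ {x} → ¬ (x ≈ 0#) → ¬ (x ⁻¹ ≈ 0#)
  inverse-nonzero {x} x≉0 = unit-nonzero x (inverseˡ x x≉0)

  inverse-unique : ∀ x {y} → x * y ≈ 1# → y ≈ x ⁻¹
  inverse-unique x {y} xy≈1 =
    *-cancelˡ x x≉0 (trans xy≈1 (sym (inverseʳ x x≉0)))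
    where x≉0 = unit-nonzero y xy≈1

  neg-nonzero : ∀ {x} → ¬ (x ≈ 0#) → ¬ (- x ≈ 0#)
  neg-nonzero {x} x≉0 -x≈0 = x≉0 (begin
    x        ≈⟨ solve 1 (λ x → x := :- (:- x)) refl x ⟩
    - (- x)  ≈⟨ -‿cong -x≈0 ⟩
    - 0#     ≈⟨ solve 0 (:- con (+ 0) := con (+ 0)) refl ⟩
    0#       ∎)

  -- p ≈ q turns l ≈ r into an identity checkable by the ring solver once the multiplier u is known.
  modulo : ∀ {l r p q} u → p ≈ q → l ≈ r + u * (p - q) → l ≈ r
  modulo {l} {r} {p} {q} u p≈q l≈ = begin
    l                ≈⟨ l≈ ⟩
    r + u * (p - q)  ≈⟨ +-congˡ (*-congˡ (+-congʳ p≈q)) ⟩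
    r + u * (q - q)  ≈⟨ solve 3 (λ r u q → r :+ u :* (q :- q) := r) refl r u q ⟩
    r                ∎

  difference-zero : ∀ {x y} → x - y ≈ 0# → x ≈ y
  difference-zero {x} {y} d =
    modulo 1# d (solve 2 (λ x y → x := y :+ con (+ 1) :* (x :- y :- con (+ 0))) refl x y)

  difference-nonzero : ∀ {x y} → ¬ (x ≈ y) → ¬ (x - y ≈ 0#)
  difference-nonzero x≉y d = x≉y (difference-zero d)

-- Sums over F: indicators, exchange of summation, substitution.

module Summation {c ℓ c′ ℓ′} (F : FiniteField c ℓ) (R : CommutativeRing c′ ℓ′) where
  private module F = FiniteField F
  open CommutativeRing R
  open IntegerSolver R
  open SetoidReasoning setoid

  sumOver : List F.Carrier → (F.Carrier → Carrier) → Carrier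
  sumOver xs f = foldr (λ x acc → f x + acc) 0# xs

  sum : (F.Carrier → Carrier) → Carrier
  sum = sumOver F.elements

  -- Iverson bracket. A sum over the solutions of an equation is written as a bracketed sum over all
  -- of F, so that `sum-swap` applies to it.
  ⟦_⟧ : ∀ {p} {P : Set p} → Dec P → Carrier
  ⟦ yes _ ⟧ = 1#
  ⟦ no _ ⟧  = 0#

  ⟦⟧-yes : ∀ {p} {P : Set p} (P? : Dec P) → P → ⟦ P? ⟧ ≈ 1#
  ⟦⟧-yes (yes _) p = refl
  ⟦⟧-yes (no ¬p) p = contradiction p ¬p

  ⟦⟧-no : ∀ {p} {P : Set p} (P? : Dec P) → ¬ P → ⟦ P? ⟧ ≈ 0#
  ⟦⟧-no (yes p) ¬p = contradiction p ¬p
  ⟦⟧-no (no _) ¬p  = refl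

  ⟦⟧-⇔ : ∀ {p q} {P : Set p} {Q : Set q} (P? : Dec P) (Q? : Dec Q) → (P → Q) → (Q → P) → ⟦ P? ⟧ ≈ ⟦ Q? ⟧
  ⟦⟧-⇔ (yes p) Q? to from = sym (⟦⟧-yes Q? (to p))
  ⟦⟧-⇔ (no ¬p) Q? to from = sym (⟦⟧-no Q? (λ q → ¬p (from q)))

  -- Allows a rewriting of the summand to use the condition in the bracket.
  ⟦⟧-*-cong : ∀ {p} {P : Set p} (P? : Dec P) {x y} → (P → x ≈ y) → ⟦ P? ⟧ * x ≈ ⟦ P? ⟧ * y
  ⟦⟧-*-cong (yes p) x≈y = *-congˡ (x≈y p)
  ⟦⟧-*-cong (no _)  x≈y = trans (zeroˡ _) (sym (zeroˡ _))

  private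
    over-cong : ∀ xs {f g} → (∀ x → f x ≈ g x) → sumOver xs f ≈ sumOver xs g
    over-cong []       f≈g = refl
    over-cong (x ∷ xs) f≈g = +-cong (f≈g x) (over-cong xs f≈g)

    over-zero : ∀ xs → sumOver xs (λ _ → 0#) ≈ 0#
    over-zero []       = refl
    over-zero (x ∷ xs) = trans (+-identityˡ _) (over-zero xs)

    over-+ : ∀ xs f g → sumOver xs (λ x → f x + g x) ≈ sumOver xs f + sumOver xs g
    over-+ []       f g = sym (+-identityˡ _)
    over-+ (x ∷ xs) f g = trans (+-congˡ (over-+ xs f g))
      (solve 4 (λ a b s t → (a :+ b) :+ (s :+ t) := (a :+ s) :+ (b :+ t)) refl (f x) (g x) _ _)

    over-*ˡ : ∀ xs k f → sumOver xs (λ x → k * f x) ≈ k * sumOver xs f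
    over-*ˡ []       k f = sym (zeroʳ k)
    over-*ˡ (x ∷ xs) k f = trans (+-congˡ (over-*ˡ xs k f)) (sym (distribˡ _ _ _))

    over-swap : ∀ xs ys (h : F.Carrier → F.Carrier → Carrier) →
      sumOver xs (λ x → sumOver ys (h x)) ≈ sumOver ys (λ y → sumOver xs (λ x → h x y))
    over-swap []       ys h = sym (over-zero ys)
    over-swap (x ∷ xs) ys h = trans (+-congˡ (over-swap xs ys h)) (sym (over-+ ys (h x) _))

    over-absent : ∀ xs {p} {P : F.Carrier → Set p} (P? : ∀ x → Dec (P x)) x₀ →
      (∀ {x} → P x → x F.≈ x₀) → All (λ x → ¬ (x₀ F.≈ x)) xs → sumOver xs (λ x → ⟦ P? x ⟧) ≈ 0#
    over-absent []       P? x₀ to [] = refl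
    over-absent (x ∷ xs) P? x₀ to (x₀≉x ∷ rest) =
      trans (+-cong (⟦⟧-no (P? x) (λ p → x₀≉x (F.sym (to p)))) (over-absent xs P? x₀ to rest)) (+-identityˡ _)

    over-unique : ∀ xs {p} {P : F.Carrier → Set p} (P? : ∀ x → Dec (P x)) x₀ →
      (∀ {x} → P x → x F.≈ x₀) → (∀ {x} → x F.≈ x₀ → P x) →
      Any (x₀ F.≈_) xs → AllPairs (λ a b → ¬ (a F.≈ b)) xs → sumOver xs (λ x → ⟦ P? x ⟧) ≈ 1#
    over-unique (x ∷ xs) P? x₀ to from (here x₀≈x) (x≉xs ∷ _) = trans
      (+-cong (⟦⟧-yes (P? x) (from (F.sym x₀≈x)))
        (over-absent xs P? x₀ to (All.map (λ x≉y x₀≈y → x≉y (F.trans (F.sym x₀≈x) x₀≈y)) x≉xs)))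
      (+-identityʳ _)
    over-unique (x ∷ xs) P? x₀ to from (there x₀∈xs) (x≉xs ∷ distinct) = trans
      (+-cong (⟦⟧-no (P? x) (λ p → absent x≉xs x₀∈xs (to p))) (over-unique xs P? x₀ to from x₀∈xs distinct))
      (+-identityˡ _)
      where
      absent : ∀ {ys} → All (λ y → ¬ (x F.≈ y)) ys → Any (x₀ F.≈_) ys → ¬ (x F.≈ x₀)
      absent (x≉y ∷ _) (here x₀≈y) x≈x₀ = x≉y (F.trans x≈x₀ x₀≈y)
      absent (_ ∷ x≉ys) (there x₀∈ys) x≈x₀ = absent x≉ys x₀∈ys x≈x₀

  sum-cong : ∀ {f g} → (∀ x → f x ≈ g x) → sum f ≈ sum g
  sum-cong = over-cong F.elements

  sum-zero : ∀ {f} → (∀ x → f x ≈ 0#) → sum f ≈ 0#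
  sum-zero f≈0 = trans (sum-cong f≈0) (over-zero F.elements)

  sum-+ : ∀ f g → sum (λ x → f x + g x) ≈ sum f + sum g
  sum-+ = over-+ F.elements

  sum-*ˡ : ∀ k f → sum (λ x → k * f x) ≈ k * sum f
  sum-*ˡ = over-*ˡ F.elements

  sum-*ʳ : ∀ k f → sum (λ x → f x * k) ≈ sum f * k
  sum-*ʳ k f = trans (sum-cong (λ x → *-comm (f x) k)) (trans (sum-*ˡ k f) (*-comm k _))

  sum-neg : ∀ f → sum (λ x → - f x) ≈ - sum f
  sum-neg f = begin
    sum (λ x → - f x)       ≈⟨ sum-cong (λ x → minus (f x)) ⟩
    sum (λ x → - 1# * f x)  ≈⟨ sum-*ˡ (- 1#) f ⟩
    - 1# * sum f            ≈⟨ minus (sum f) ⟨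
    - sum f                 ∎
    where
    minus : ∀ x → - x ≈ - 1# * x
    minus = solve 1 (λ x → :- x := (:- con (+ 1)) :* x) refl

  sum-- : ∀ f g → sum (λ x → f x - g x) ≈ sum f - sum g
  sum-- f g = trans (sum-+ f (λ x → - g x)) (+-congˡ (sum-neg g))

  sum-swap : ∀ (h : F.Carrier → F.Carrier → Carrier) →
    sum (λ x → sum (h x)) ≈ sum (λ y → sum (λ x → h x y))
  sum-swap = over-swap F.elements F.elements

  count-unique : ∀ {p} {P : F.Carrier → Set p} (P? : ∀ x → Dec (P x)) x₀ →
    (∀ {x} → P x → x F.≈ x₀) → (∀ {x} → x F.≈ x₀ → P x) → sum (λ x → ⟦ P? x ⟧) ≈ 1#
  count-unique P? x₀ to from = over-unique F.elements P? x₀ to from (F.complete x₀) F.distinct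

  sum-unique : ∀ {p} {P : F.Carrier → Set p} (P? : ∀ x → Dec (P x)) x₀ (f : F.Carrier → Carrier) →
    (∀ {x} → P x → x F.≈ x₀) → (∀ {x} → x F.≈ x₀ → P x) → (∀ {x} → P x → f x ≈ f x₀) →
    sum (λ x → ⟦ P? x ⟧ * f x) ≈ f x₀
  sum-unique P? x₀ f to from f-cong = begin
    sum (λ x → ⟦ P? x ⟧ * f x)   ≈⟨ sum-cong (λ x → ⟦⟧-*-cong (P? x) f-cong) ⟩
    sum (λ x → ⟦ P? x ⟧ * f x₀)  ≈⟨ sum-*ʳ (f x₀) _ ⟩
    sum (λ x → ⟦ P? x ⟧) * f x₀  ≈⟨ *-congʳ (count-unique P? x₀ to from) ⟩
    1# * f x₀                    ≈⟨ *-identityˡ _ ⟩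
    f x₀                         ∎

  -- Points outside the range of σ, or with several preimages, are harmless where g vanishes.
  sum-reindex : (σ : F.Carrier → F.Carrier) → (∀ {x y} → x F.≈ y → σ x F.≈ σ y) →
    ∀ f (g : F.Carrier → Carrier) → (∀ {x y} → x F.≈ y → g x ≈ g y) → (∀ x → f x ≈ g (σ x)) →
    (∀ y → g y ≈ 0# ⊎ Σ F.Carrier λ x → σ x F.≈ y × (∀ {x′} → σ x′ F.≈ y → x′ F.≈ x)) →
    sum f ≈ sum g
  sum-reindex σ σ-cong f g g-cong f≈gσ preimage = begin
    sum f                                             ≈⟨ sum-cong f≈gσ ⟩
    -- Double counting on the graph of `σ`: each x lies over exactly one y, and each y either has
    -- exactly one x or satisfies g y ≈ 0.
    sum (λ x → g (σ x))                               ≈⟨ sum-cong pick ⟨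
    sum (λ x → sum (λ y → ⟦ y F.≟ σ x ⟧ * g y))       ≈⟨ sum-swap _ ⟩
    sum (λ y → sum (λ x → ⟦ y F.≟ σ x ⟧ * g y))       ≈⟨ sum-cong fibre ⟩
    sum g                                             ∎
    where
    pick : ∀ x → sum (λ y → ⟦ y F.≟ σ x ⟧ * g y) ≈ g (σ x)
    pick x = sum-unique (λ y → y F.≟ σ x) (σ x) g (λ p → p) (λ p → p) (λ p → g-cong p)
    fibre : ∀ y → sum (λ x → ⟦ y F.≟ σ x ⟧ * g y) ≈ g y
    fibre y with preimage y
    ... | inj₁ gy≈0 = trans (sum-zero (λ x → trans (*-congˡ gy≈0) (zeroʳ _))) (sym gy≈0)
    ... | inj₂ (x₀ , σx₀≈y , unique) = begin
      sum (λ x → ⟦ y F.≟ σ x ⟧ * g y)  ≈⟨ sum-*ʳ (g y) _ ⟩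
      sum (λ x → ⟦ y F.≟ σ x ⟧) * g y
        ≈⟨ *-congʳ (count-unique (λ x → y F.≟ σ x) x₀ (λ p → unique (F.sym p))
             (λ p → F.sym (F.trans (σ-cong p) σx₀≈y))) ⟩
      1# * g y                         ≈⟨ *-identityˡ _ ⟩
      g y                              ∎

  sum-bijection : (σ τ : F.Carrier → F.Carrier) → (∀ {x y} → x F.≈ y → σ x F.≈ σ y) →
    (∀ {x y} → x F.≈ y → τ x F.≈ τ y) → (∀ y → σ (τ y) F.≈ y) → (∀ x → τ (σ x) F.≈ x) →
    ∀ f (g : F.Carrier → Carrier) → (∀ {x y} → x F.≈ y → g x ≈ g y) → (∀ x → f x ≈ g (σ x)) → sum f ≈ sum g
  sum-bijection σ τ σ-cong τ-cong στ τσ f g g-cong f≈gσ = sum-reindex σ σ-cong f g g-cong f≈gσ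
    (λ y → inj₂ (τ y , στ y , λ {x} σx≈y → F.trans (F.sym (τσ x)) (τ-cong σx≈y)))

module Counting {c ℓ c′ ℓ′} (F : FiniteField c ℓ) (K : Field c′ ℓ′) where
  private module F = FiniteField F
  open Field K
  open Summation F commutativeRing

  sum-1 : sum (λ _ → 1#) ≈ natCast F.q
  sum-1 = over F.elements
    where
    over : ∀ xs → sumOver xs (λ _ → 1#) ≈ natCast (length xs)
    over []       = refl
    over (x ∷ xs) = +-congˡ (over xs)

-- Odd cardinality makes 2 invertible.

module OddFiniteField {c ℓ} (F : FiniteField c ℓ) (odd : FiniteField.q F % 2 ≡ 1) where
  open FiniteField F
  open FieldProperties field′
  open Summation F commutativeRing
  open Counting F field′
  open IntegerSolver commutativeRing
  open SetoidReasoning setoid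

  -- Translation by 1 permutes F, so Σ x ≈ Σ (x + 1).
  natCast-q≈0 : natCast q ≈ 0#
  natCast-q≈0 = begin
    natCast q                                          ≈⟨ solve 2 (λ s n → n := (s :+ n) :- s) refl (sum (λ x → x)) _ ⟩
    (sum (λ x → x) + natCast q) - sum (λ x → x)        ≈⟨ +-congʳ (+-congˡ sum-1) ⟨
    (sum (λ x → x) + sum (λ _ → 1#)) - sum (λ x → x)   ≈⟨ +-congʳ (sum-+ (λ x → x) (λ _ → 1#)) ⟨
    sum (λ x → x + 1#) - sum (λ x → x)                 ≈⟨ +-congʳ translate ⟩
    sum (λ x → x) - sum (λ x → x)                      ≈⟨ -‿inverseʳ _ ⟩
    0#                                                 ∎
    where
    translate : sum (λ x → x + 1#) ≈ sum (λ x → x)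
    translate = sum-bijection (λ x → x + 1#) (λ x → x - 1#) +-congʳ +-congʳ
      (solve 1 (λ x → (x :- con (+ 1)) :+ con (+ 1) := x) refl)
      (solve 1 (λ x → (x :+ con (+ 1)) :- con (+ 1) := x) refl)
      (λ x → x + 1#) (λ x → x) (λ p → p) (λ _ → refl)

  private
    natCast-odd : 1# + 1# ≈ 0# → ∀ n → n % 2 ≡ 1 → natCast n ≈ 1#
    natCast-odd 2≈0 (suc zero) _ = +-identityʳ 1#
    natCast-odd 2≈0 (suc (suc n)) n-odd = begin
      1# + (1# + natCast n)  ≈⟨ +-assoc _ _ _ ⟨
      1# + 1# + natCast n    ≈⟨ +-cong 2≈0 (natCast-odd 2≈0 n n-odd) ⟩
      0# + 1#                ≈⟨ +-identityˡ 1# ⟩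
      1#                     ∎

  2# : Carrier
  2# = 1# + 1#

  -- If 2 were 0, every odd multiple of 1 would be 1; but q is odd and q times 1 is 0.
  2≉0 : ¬ (2# ≈ 0#)
  2≉0 2≈0 = 1≉0 (trans (sym (natCast-odd 2≈0 q odd)) natCast-q≈0)

  q≢0 : ¬ (q ≡ 0)
  q≢0 q≡0 with ≡.subst (λ n → n % 2 ≡ 1) q≡0 odd
  ... | ()

  q≢1 : ¬ (q ≡ 1)
  q≢1 q≡1 = 1≉0 (trans (sym (+-identityʳ 1#))
    (trans (reflexive (≡.cong natCast (≡.sym q≡1))) natCast-q≈0))

  double-nonzero : ∀ {x} → ¬ (x ≈ 0#) → ¬ (x + x ≈ 0#)
  double-nonzero {x} x≉0 2x≈0 = *-nonzero 2≉0 x≉0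
    (trans (solve 1 (λ x → (con (+ 1) :+ con (+ 1)) :* x := x :+ x) refl x) 2x≈0)

-- Characters with values in a field of characteristic 0, and their sums.

module CharacterSums {c ℓ c′ ℓ′} (F : FiniteField c ℓ) (odd : FiniteField.q F % 2 ≡ 1)
  (K : Field c′ ℓ′) (char0 : CharZero K) where
  module F where
    open FiniteField F public
    open FieldProperties field′ public
    open OddFiniteField F odd public using (2#; 2≉0; q≢0; q≢1; double-nonzero)
    module Solver = IntegerSolver commutativeRing
  open Field K
  open FieldProperties K
  open Summation F commutativeRing public
  open Counting F K public
  open IntegerSolver commutativeRing
  open SetoidReasoning setoid
  open Character
  open F.Solver public using () renaming
    (solve to solveF; _:+_ to _⊞_; _:*_ to _⊠_; _:-_ to _⊟_; :-_ to ⊟_; _:=_ to _⊜_; con to conF)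

  q′ : Carrier
  q′ = natCast F.q

  q′≉0 : ¬ (q′ ≈ 0#)
  q′≉0 q′≈0 = F.q≢0 (char0 F.q q′≈0)

  q′-1≉0 : ¬ (q′ - 1# ≈ 0#)
  q′-1≉0 = go F.q F.q≢0 F.q≢1
    where
    go : ∀ n → ¬ (n ≡ 0) → ¬ (n ≡ 1) → ¬ (natCast n - 1# ≈ 0#)
    go zero    n≢0 n≢1 _ = n≢0 ≡.refl
    go (suc n) n≢0 n≢1 p = n≢1 (≡.cong suc (char0 n
      (trans (solve 1 (λ m → m := con (+ 1) :+ m :- con (+ 1)) refl (natCast n)) p)))

  2≉0 : ¬ (1# + 1# ≈ 0#)
  2≉0 2≈0 with char0 2 (trans (+-congˡ (+-identityʳ 1#)) 2≈0)
  ... | ()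

  -- The sum of brackets is the image in K of the number of solutions; in characteristic 0 the image
  -- vanishes only if the number does.
  count≈0⇒none : ∀ {p} {P : F.Carrier → Set p} (P? : ∀ x → Dec (P x)) →
    (∀ {x y} → x F.≈ y → P x → P y) → sum (λ x → ⟦ P? x ⟧) ≈ 0# → ∀ x → ¬ P x
  count≈0⇒none {P = P} P? resp count≈0 x px with cardinality F.elements
    where
    cardinality : ∀ xs → Σ ℕ λ n →
      sumOver xs (λ x → ⟦ P? x ⟧) ≈ natCast n × (n ≡ 0 → All (λ x → ¬ P x) xs)
    cardinality [] = 0 , refl , λ _ → []
    cardinality (x ∷ xs) with cardinality xs | P? x
    ... | n , Σ≈n , none | yes px = suc n , +-congˡ Σ≈n , λ ()
    ... | n , Σ≈n , none | no ¬px = n , trans (+-identityˡ _) Σ≈n , λ n≡0 → ¬px ∷ none n≡0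
  ... | n , Σ≈n , none = absurd (none (char0 n (trans (sym Σ≈n) count≈0))) (F.complete x)
    where
    absurd : ∀ {xs} → All (λ x → ¬ P x) xs → Any (x F.≈_) xs → ⊥
    absurd (¬py ∷ _)  (here x≈y) = ¬py (resp x≈y px)
    absurd (_ ∷ none) (there x∈) = absurd none x∈

  χ-zero : (X : Character F K) → ∀ {x} → x F.≈ F.0# → χ X x ≈ 0#
  χ-zero X x≈0 = trans (χ-cong X x≈0) (χ-0 X)

  χ-unit : (X : Character F K) → ∀ {x} → ¬ (x F.≈ F.0#) → χ X x * χ X (x F.⁻¹) ≈ 1#
  χ-unit X {x} x≉0 = trans (sym (χ-* X _ _)) (trans (χ-cong X (F.inverseʳ x x≉0)) (χ-1 X))

  χ-nonzero : (X : Character F K) → ∀ {x} → ¬ (x F.≈ F.0#) → ¬ (χ X x ≈ 0#)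
  χ-nonzero X x≉0 = unit-nonzero _ (χ-unit X x≉0)

  infixl 7 _⊗_

  _⊗_ : Character F K → Character F K → Character F K
  X ⊗ Y = record
    { χ      = _·_ F K (χ X) (χ Y)
    ; χ-cong = λ x≈y → *-cong (χ-cong X x≈y) (χ-cong Y x≈y)
    ; χ-0    = trans (*-congʳ (χ-0 X)) (zeroˡ _)
    ; χ-1    = trans (*-cong (χ-1 X) (χ-1 Y)) (*-identityˡ 1#)
    ; χ-*    = λ x y → trans (*-cong (χ-* X x y) (χ-* Y x y))
                 (solve 4 (λ a b c d → (a :* b) :* (c :* d) := (a :* c) :* (b :* d)) refl _ _ _ _)
    }

  χ⁻¹-inverse : (X : Character F K) → ∀ {x} → ¬ (x F.≈ F.0#) → χ X x * χ X x ⁻¹ ≈ 1#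
  χ⁻¹-inverse X x≉0 = inverseʳ _ (χ-nonzero X x≉0)

  χ⁻¹-zero : (X : Character F K) → ∀ {x} → x F.≈ F.0# → χ X x ⁻¹ ≈ 0#
  χ⁻¹-zero X x≈0 = trans (⁻¹-cong (χ-zero X x≈0)) 0⁻¹≈0

  inv : Character F K → Character F K
  inv X = record
    { χ      = conj F K (χ X)
    ; χ-cong = λ x≈y → ⁻¹-cong (χ-cong X x≈y)
    ; χ-0    = χ⁻¹-zero X F.refl
    ; χ-1    = sym (inverse-unique (χ X F.1#) (trans (*-identityʳ _) (χ-1 X)))
    ; χ-*    = multiplicative
    }
    where
    multiplicative : ∀ x y → χ X (x F.* y) ⁻¹ ≈ χ X x ⁻¹ * χ X y ⁻¹
    multiplicative x y with x F.≟ F.0# | y F.≟ F.0#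
    ... | yes x≈0 | _ = trans (χ⁻¹-zero X (F.trans (F.*-congʳ x≈0) (F.zeroˡ y)))
      (sym (trans (*-congʳ (χ⁻¹-zero X x≈0)) (zeroˡ _)))
    ... | no _ | yes y≈0 = trans (χ⁻¹-zero X (F.trans (F.*-congˡ y≈0) (F.zeroʳ x)))
      (sym (trans (*-congˡ (χ⁻¹-zero X y≈0)) (zeroʳ _)))
    ... | no x≉0 | no y≉0 = sym (inverse-unique _ (begin
      χ X (x F.* y) * (χ X x ⁻¹ * χ X y ⁻¹)      ≈⟨ *-congʳ (χ-* X x y) ⟩
      χ X x * χ X y * (χ X x ⁻¹ * χ X y ⁻¹)
        ≈⟨ solve 4 (λ a b c d → a :* b :* (c :* d) := (a :* c) :* (b :* d)) refl _ _ _ _ ⟩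
      (χ X x * χ X x ⁻¹) * (χ X y * χ X y ⁻¹)    ≈⟨ *-cong (χ⁻¹-inverse X x≉0) (χ⁻¹-inverse X y≉0) ⟩
      1# * 1#                                    ≈⟨ *-identityˡ 1# ⟩
      1#                                         ∎))

  sum-trivial : sum (trivial F K) ≈ q′ - 1#
  sum-trivial = begin
    sum (trivial F K)                                    ≈⟨ sum-cong split ⟩
    sum (λ x → 1# - ⟦ x F.≟ F.0# ⟧)                      ≈⟨ sum-- _ _ ⟩
    sum (λ _ → 1#) - sum (λ x → ⟦ x F.≟ F.0# ⟧)
      ≈⟨ +-cong sum-1 (-‿cong (count-unique (λ x → x F.≟ F.0#) F.0# (λ p → p) (λ p → p))) ⟩
    q′ - 1#                                              ∎
    where
    split : ∀ x → trivial F K x ≈ 1# - ⟦ x F.≟ F.0# ⟧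
    split x with x F.≟ F.0#
    ... | yes _ = sym (-‿inverseʳ 1#)
    ... | no _  = solve 0 (con (+ 1) := con (+ 1) :- con (+ 0)) refl

  sum-scale : ∀ {y} → ¬ (y F.≈ F.0#) → (f : F.Carrier → Carrier) → (∀ {x y} → x F.≈ y → f x ≈ f y) →
    sum (λ x → f (y F.* x)) ≈ sum f
  sum-scale {y} y≉0 f f-cong = sum-bijection (y F.*_) (y F.⁻¹ F.*_) F.*-congˡ F.*-congˡ
    (cancel (F.inverseʳ y y≉0)) (cancel (F.inverseˡ y y≉0)) (λ x → f (y F.* x)) f f-cong (λ _ → refl)
    where
    cancel : ∀ {s t} → s F.* t F.≈ F.1# → ∀ x → s F.* (t F.* x) F.≈ x
    cancel st≈1 x = F.trans (F.sym (F.*-assoc _ _ _)) (F.trans (F.*-congʳ st≈1) (F.*-identityˡ x))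

  -- Multiplication by a nonzero y permutes F and so fixes the sum up to the factor χ(y); at y ≈ 0
  -- both sides vanish. Using `trivial` as the factor covers both cases, so the identity can itself
  -- be summed over y.
  χ-*-sum : (X : Character F K) → ∀ y → χ X y * sum (χ X) ≈ trivial F K y * sum (χ X)
  χ-*-sum X y with y F.≟ F.0#
  ... | yes y≈0 = *-congʳ (χ-zero X y≈0)
  ... | no y≉0  = begin
    χ X y * sum (χ X)            ≈⟨ sum-*ˡ _ _ ⟨
    sum (λ x → χ X y * χ X x)
      ≈⟨ sum-cong (λ x → χ-* X y x) ⟨
    sum (λ x → χ X (y F.* x))    ≈⟨ sum-scale y≉0 (χ X) (χ-cong X) ⟩
    sum (χ X)                    ≈⟨ *-identityˡ _ ⟨
    1# * sum (χ X)               ∎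

  -- Encodes the dichotomy that Σ χ is 0 or q - 1 as a polynomial identity, since equality in K
  -- cannot be decided.
  sum-χ-squared : (X : Character F K) → sum (χ X) * sum (χ X) ≈ (q′ - 1#) * sum (χ X)
  sum-χ-squared X = begin
    sum (χ X) * sum (χ X)                  ≈⟨ sum-*ʳ _ _ ⟨
    sum (λ y → χ X y * sum (χ X))          ≈⟨ sum-cong (χ-*-sum X) ⟩
    sum (λ y → trivial F K y * sum (χ X))  ≈⟨ sum-*ʳ _ _ ⟩
    sum (trivial F K) * sum (χ X)          ≈⟨ *-congʳ sum-trivial ⟩
    (q′ - 1#) * sum (χ X)                  ∎

  -- K need not have decidable equality, so no y with χ y ≉ 1 can be exhibited; but S = Σ χ satisfies
  -- (S - (q - 1)) S ≈ 0, and S ≈ q - 1 would force χ to be trivial.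
  sum-nontrivial : (X : Character F K) → Nontrivial F K (χ X) → sum (χ X) ≈ 0#
  sum-nontrivial X nontrivial = *-zero-cancelˡ (S - (q′ - 1#)) S≉q-1 (begin
    (S - (q′ - 1#)) * S        ≈⟨ solve 2 (λ s q → (s :- q) :* s := s :* s :- q :* s) refl S (q′ - 1#) ⟩
    S * S - (q′ - 1#) * S      ≈⟨ +-congʳ (sum-χ-squared X) ⟩
    (q′ - 1#) * S - (q′ - 1#) * S  ≈⟨ -‿inverseʳ _ ⟩
    0#                         ∎)
    where
    S = sum (χ X)
    S≉q-1 : ¬ (S - (q′ - 1#) ≈ 0#)
    S≉q-1 S≈q-1 = nontrivial (λ y → *-cancelˡ S S≉0
      (trans (*-comm _ _) (trans (χ-*-sum X y) (*-comm _ _))))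
      where
      S≉0 : ¬ (S ≈ 0#)
      S≉0 S≈0 = q′-1≉0 (trans (sym (difference-zero S≈q-1)) S≈0)

  convolution : Character F K → Character F K → F.Carrier → Carrier
  convolution X Y v = sum (λ s → χ X s * χ Y (v F.- s))

  convolution-nonzero : (X Y : Character F K) → ∀ {v} → ¬ (v F.≈ F.0#) →
    convolution X Y v ≈ χ X v * χ Y v * J F K (χ X) (χ Y)
  convolution-nonzero X Y {v} v≉0 = begin
    convolution X Y v
      ≈⟨ sum-scale v≉0 (λ s → χ X s * χ Y (v F.- s)) (λ p → *-cong (χ-cong X p) (χ-cong Y (F.+-congˡ (F.-‿cong p)))) ⟨
    sum (λ t → χ X (v F.* t) * χ Y (v F.- v F.* t))                ≈⟨ sum-cong scale ⟨
    sum (λ t → χ X v * χ Y v * (χ X t * χ Y (F.1# F.- t)))         ≈⟨ sum-*ˡ _ _ ⟩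
    χ X v * χ Y v * J F K (χ X) (χ Y)                              ∎
    where
    scale : ∀ t → χ X v * χ Y v * (χ X t * χ Y (F.1# F.- t)) ≈ χ X (v F.* t) * χ Y (v F.- v F.* t)
    scale t = begin
      χ X v * χ Y v * (χ X t * χ Y (F.1# F.- t))
        ≈⟨ solve 4 (λ a b c d → a :* b :* (c :* d) := (a :* c) :* (b :* d)) refl _ _ _ _ ⟩
      χ X v * χ X t * (χ Y v * χ Y (F.1# F.- t))
        ≈⟨ *-cong (χ-* X _ _) (χ-* Y _ _) ⟨
      χ X (v F.* t) * χ Y (v F.* (F.1# F.- t))
        ≈⟨ *-congˡ (χ-cong Y (solveF 2 (λ v t → v ⊠ (conF (+ 1) ⊟ t) ⊜ v ⊟ v ⊠ t) F.refl v t)) ⟩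
      χ X (v F.* t) * χ Y (v F.- v F.* t) ∎

  χ-neg : (X : Character F K) → ∀ x → χ X (F.- x) ≈ χ X (F.- F.1#) * χ X x
  χ-neg X x = trans (χ-cong X (solveF 1
    (λ x → ⊟ x ⊜ (⊟ conF (+ 1)) ⊠ x) F.refl x)) (χ-* X _ _)

  convolution-zero : (X Y : Character F K) → ∀ {v} → v F.≈ F.0# →
    convolution X Y v ≈ χ Y (F.- F.1#) * sum (χ (X ⊗ Y))
  convolution-zero X Y {v} v≈0 = trans (sum-cong (λ s → begin
    χ X s * χ Y (v F.- s)                ≈⟨ *-congˡ (χ-cong Y (F.trans (F.+-congʳ v≈0) (F.+-identityˡ _))) ⟩
    χ X s * χ Y (F.- s)                  ≈⟨ *-congˡ (χ-neg Y s) ⟩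
    χ X s * (χ Y (F.- F.1#) * χ Y s)     ≈⟨ solve 3 (λ a b c → a :* (b :* c) := b :* (a :* c)) refl _ _ _ ⟩
    χ Y (F.- F.1#) * (χ X s * χ Y s)     ∎)) (sum-*ˡ _ _)

  -1≉0 : ¬ (F.- F.1# F.≈ F.0#)
  -1≉0 = F.neg-nonzero F.1≉0

  sum-χ⊗inv : (Y : Character F K) → sum (χ (inv Y ⊗ Y)) ≈ q′ - 1#
  sum-χ⊗inv Y = trans (sum-cong pointwise) sum-trivial
    where
    pointwise : ∀ x → χ (inv Y ⊗ Y) x ≈ trivial F K x
    pointwise x with x F.≟ F.0#
    ... | yes x≈0 = χ-zero (inv Y ⊗ Y) x≈0
    ... | no x≉0  = trans (*-comm _ _) (χ⁻¹-inverse Y x≉0)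

  sum-reflect : ∀ k f → (∀ {x y} → x F.≈ y → f x ≈ f y) → sum (λ x → f (k F.- x)) ≈ sum f
  sum-reflect k f f-cong = sum-bijection (λ x → k F.- x) (λ x → k F.- x) sub-cong sub-cong involutive involutive
    (λ x → f (k F.- x)) f f-cong (λ _ → refl)
    where
    sub-cong : ∀ {x y} → x F.≈ y → k F.- x F.≈ k F.- y
    sub-cong p = F.+-congˡ (F.-‿cong p)
    involutive : ∀ x → k F.- (k F.- x) F.≈ x
    involutive = solveF 2 (λ k x → k ⊟ (k ⊟ x) ⊜ x) F.refl k

  -- Jacobi sums

  jacobi : Character F K → Character F K → Carrier
  jacobi X Y = J F K (χ X) (χ Y)

  sum-translate : ∀ k (f : F.Carrier → Carrier) → (∀ {x y} → x F.≈ y → f x ≈ f y) →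
    sum (λ x → f (x F.- k)) ≈ sum f
  sum-translate k f f-cong = sum-bijection (λ x → x F.- k) (λ x → x F.+ k) F.+-congʳ F.+-congʳ
    (λ x → solveF 2 (λ k x → (x ⊞ k) ⊟ k ⊜ x) F.refl k x) (λ x → solveF 2 (λ k x → (x ⊟ k) ⊞ k ⊜ x) F.refl k x)
    (λ x → f (x F.- k)) f f-cong (λ _ → refl)

  -- For completing squares: x ↦ 2x - T is a bijection because 2 is invertible.
  sum-affine : ∀ T (f : F.Carrier → Carrier) → (∀ {x y} → x F.≈ y → f x ≈ f y) →
    sum (λ x → f (F.2# F.* x F.- T)) ≈ sum f
  sum-affine T f f-cong = trans
    (sum-scale F.2≉0 (λ x → f (x F.- T)) (λ x≈y → f-cong (F.+-congʳ x≈y)))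
    (sum-translate T f f-cong)

  -- One formula for both cases, so that it can be summed over v: at v ≈ 0 the Jacobi term vanishes
  -- with χ X v, elsewhere the bracket does.
  convolution-value : (X Y : Character F K) → ∀ v →
    convolution X Y v ≈ ⟦ v F.≟ F.0# ⟧ * (χ Y (F.- F.1#) * sum (χ (X ⊗ Y))) + χ X v * χ Y v * jacobi X Y
  convolution-value X Y v with v F.≟ F.0#
  ... | yes v≈0 = trans (convolution-zero X Y v≈0) (sym (begin
    1# * m + χ X v * χ Y v * j  ≈⟨ +-congˡ (*-congʳ (*-congʳ (χ-zero X v≈0))) ⟩
    1# * m + 0# * χ Y v * j     ≈⟨ solve 3 (λ m y j → con (+ 1) :* m :+ con (+ 0) :* y :* j := m) refl m _ j ⟩
    m                           ∎))
    where
    m = χ Y (F.- F.1#) * sum (χ (X ⊗ Y))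
    j = jacobi X Y
  ... | no v≉0  = trans (convolution-nonzero X Y v≉0)
    (solve 2 (λ m p → p := con (+ 0) :* m :+ p) refl (χ Y (F.- F.1#) * sum (χ (X ⊗ Y))) _)

  sum-⟦≟⟧ : ∀ k → sum (λ x → ⟦ x F.≟ k ⟧) ≈ 1#
  sum-⟦≟⟧ k = count-unique (λ x → x F.≟ k) k (λ p → p) (λ p → p)

  -- The convolution of Y⁻¹ and Y is constant off 0, and its total is ΣY⁻¹ ΣY ≈ 0.
  jacobi-inv : (Y : Character F K) → sum (χ Y) ≈ 0# → jacobi (inv Y) Y ≈ - χ Y (F.- F.1#)
  jacobi-inv Y ΣY≈0 = *-cancelˡ (q′ - 1#) q′-1≉0 (begin
    (q′ - 1#) * j
      ≈⟨ solve 3 (λ q j e → (q :- con (+ 1)) :* j := con (+ 1) :* (e :* (q :- con (+ 1))) :+ (q :- con (+ 1)) :* j :- e :* (q :- con (+ 1)))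
           refl q′ j e ⟩
    1# * (e * (q′ - 1#)) + (q′ - 1#) * j - e * (q′ - 1#)  ≈⟨ +-congʳ total ⟩
    0# - e * (q′ - 1#)
      ≈⟨ solve 2 (λ q e → con (+ 0) :- e :* (q :- con (+ 1)) := (q :- con (+ 1)) :* (:- e)) refl q′ e ⟩
    (q′ - 1#) * - e               ∎)
    where
    j = jacobi (inv Y) Y
    e = χ Y (F.- F.1#)
    total : 1# * (e * (q′ - 1#)) + (q′ - 1#) * j ≈ 0#
    total = begin
      1# * (e * (q′ - 1#)) + (q′ - 1#) * j
        ≈⟨ +-cong (*-cong (sum-⟦≟⟧ F.0#) (*-congˡ (sum-χ⊗inv Y))) (*-congʳ (sum-χ⊗inv Y)) ⟨
      sum (λ v → ⟦ v F.≟ F.0# ⟧) * (e * sum (χ (inv Y ⊗ Y))) + sum (χ (inv Y ⊗ Y)) * j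
        ≈⟨ +-cong (sum-*ʳ _ _) (sum-*ʳ _ _) ⟨
      sum (λ v → ⟦ v F.≟ F.0# ⟧ * (e * sum (χ (inv Y ⊗ Y)))) + sum (λ v → χ (inv Y ⊗ Y) v * j)
        ≈⟨ sum-+ _ _ ⟨
      sum (λ v → ⟦ v F.≟ F.0# ⟧ * (e * sum (χ (inv Y ⊗ Y))) + χ (inv Y ⊗ Y) v * j)
        ≈⟨ sum-cong (convolution-value (inv Y) Y) ⟨
      sum (convolution (inv Y) Y)
        ≈⟨ sum-swap _ ⟩
      sum (λ s → sum (λ v → χ (inv Y) s * χ Y (v F.- s)))
        ≈⟨ sum-zero (λ s → trans (sum-*ˡ _ _) (trans (*-congˡ (trans (sum-translate s (χ Y) (χ-cong Y)) ΣY≈0)) (zeroʳ _))) ⟩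
      0# ∎

  -- Stands in for the absolute value of a Jacobi sum. The sum `double` of Ȳ(1 - v) X(s) Y(v - s)
  -- over s and v is evaluated in both orders. Summing over s first gives a convolution of X and Y,
  -- hence the product of Jacobi sums plus the contribution of v ≈ 0; summing over v first gives
  -- Y(-1) q.
  jacobi-product : (X Y : Character F K) → sum (χ X) ≈ 0# → sum (χ Y) ≈ 0# →
    jacobi X Y * jacobi (X ⊗ Y) (inv Y) ≈ χ Y (F.- F.1#) * (q′ - sum (χ (X ⊗ Y)))
  jacobi-product X Y ΣX≈0 ΣY≈0 = begin
    j * j₂
      ≈⟨ solve 3 (λ jj e T → jj := (e :* T :+ jj) :- e :* T) refl (j * j₂) e T ⟩
    (e * T + j * j₂) - e * T    ≈⟨ +-congʳ (trans (sym by-s) by-t) ⟩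
    e * q′ - e * T              ≈⟨ solve 3 (λ e q T → e :* q :- e :* T := e :* (q :- T)) refl e q′ T ⟩
    e * (q′ - T)                ∎
    where
    j  = jacobi X Y
    j₂ = jacobi (X ⊗ Y) (inv Y)
    e  = χ Y (F.- F.1#)
    T  = sum (χ (X ⊗ Y))

    double : Carrier
    double = sum (λ v → χ (inv Y) (F.1# F.- v) * convolution X Y v)

    by-s : double ≈ e * T + j * j₂
    by-s = begin
      double
        ≈⟨ sum-cong (λ v → trans (*-congˡ (convolution-value X Y v))
             (solve 6 (λ y d e T p j → y :* (d :* (e :* T) :+ p :* j) := d :* y :* (e :* T) :+ j :* (p :* y))
                  refl _ _ e T _ j)) ⟩
      sum (λ v → ⟦ v F.≟ F.0# ⟧ * χ (inv Y) (F.1# F.- v) * (e * T) + j * (χ (X ⊗ Y) v * χ (inv Y) (F.1# F.- v)))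
        ≈⟨ sum-+ _ _ ⟩
      sum (λ v → ⟦ v F.≟ F.0# ⟧ * χ (inv Y) (F.1# F.- v) * (e * T)) + sum (λ v → j * (χ (X ⊗ Y) v * χ (inv Y) (F.1# F.- v)))
        ≈⟨ +-cong (sum-*ʳ _ _) (sum-*ˡ _ _) ⟩
      sum (λ v → ⟦ v F.≟ F.0# ⟧ * χ (inv Y) (F.1# F.- v)) * (e * T) + j * j₂
        ≈⟨ +-congʳ (*-congʳ (sum-unique (λ v → v F.≟ F.0#) F.0# (λ v → χ (inv Y) (F.1# F.- v)) (λ p → p) (λ p → p)
             (λ p → χ-cong (inv Y) (F.+-congˡ (F.-‿cong p))))) ⟩
      χ (inv Y) (F.1# F.- F.0#) * (e * T) + j * j₂
        ≈⟨ +-congʳ (*-congʳ (trans (χ-cong (inv Y) (solveF 0 (conF (+ 1) ⊟ conF (+ 0) ⊜ conF (+ 1)) F.refl)) (χ-1 (inv Y)))) ⟩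
      1# * (e * T) + j * j₂  ≈⟨ +-congʳ (*-identityˡ _) ⟩
      e * T + j * j₂ ∎

    -- In the variable 1 - v this is the convolution of Ȳ and Y at 1 - s. Up to Y(-1) it is q times
    -- the indicator of s ≈ 1 minus a constant, and the constant disappears against Σ X ≈ 0.
    inner : ∀ s → sum (λ v → χ (inv Y) (F.1# F.- v) * χ Y (v F.- s)) ≈ e * (⟦ s F.≟ F.1# ⟧ * q′ - 1#)
    inner s = begin
      sum (λ v → χ (inv Y) (F.1# F.- v) * χ Y (v F.- s))
        ≈⟨ sum-cong (λ v → *-congˡ (χ-cong Y (solveF 2 (λ v s → v ⊟ s ⊜ (conF (+ 1) ⊟ s) ⊟ (conF (+ 1) ⊟ v)) F.refl v s))) ⟩
      sum (λ v → χ (inv Y) (F.1# F.- v) * χ Y ((F.1# F.- s) F.- (F.1# F.- v)))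
        ≈⟨ sum-reflect F.1# (λ t → χ (inv Y) t * χ Y ((F.1# F.- s) F.- t))
             (λ p → *-cong (χ-cong (inv Y) p) (χ-cong Y (F.+-congˡ (F.-‿cong p)))) ⟩
      convolution (inv Y) Y (F.1# F.- s)
        ≈⟨ convolution-value (inv Y) Y (F.1# F.- s) ⟩
      ⟦ (F.1# F.- s) F.≟ F.0# ⟧ * (e * sum (χ (inv Y ⊗ Y))) + χ (inv Y ⊗ Y) (F.1# F.- s) * jacobi (inv Y) Y
        ≈⟨ +-cong (*-cong same (*-congˡ (sum-χ⊗inv Y))) (*-cong off-1 (jacobi-inv Y ΣY≈0)) ⟩
      ⟦ s F.≟ F.1# ⟧ * (e * (q′ - 1#)) + (1# - ⟦ s F.≟ F.1# ⟧) * - e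
        ≈⟨ solve 3 (λ d e q → d :* (e :* (q :- con (+ 1))) :+ (con (+ 1) :- d) :* (:- e) := e :* (d :* q :- con (+ 1)))
             refl _ e q′ ⟩
      e * (⟦ s F.≟ F.1# ⟧ * q′ - 1#) ∎
      where
      1-s≈0 : s F.≈ F.1# → F.1# F.- s F.≈ F.0#
      1-s≈0 p = F.trans (F.+-congˡ (F.-‿cong p)) (F.-‿inverseʳ F.1#)
      same : ⟦ (F.1# F.- s) F.≟ F.0# ⟧ ≈ ⟦ s F.≟ F.1# ⟧
      same = ⟦⟧-⇔ ((F.1# F.- s) F.≟ F.0#) (s F.≟ F.1#) (λ p → F.sym (F.difference-zero p)) 1-s≈0
      off-1 : χ (inv Y ⊗ Y) (F.1# F.- s) ≈ 1# - ⟦ s F.≟ F.1# ⟧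
      off-1 with s F.≟ F.1#
      ... | yes s≈1 = trans (χ-zero (inv Y ⊗ Y) (1-s≈0 s≈1)) (sym (-‿inverseʳ 1#))
      ... | no s≉1  = trans (trans (*-comm _ _) (χ⁻¹-inverse Y (λ p → s≉1 (F.sym (F.difference-zero p)))))
        (solve 0 (con (+ 1) := con (+ 1) :- con (+ 0)) refl)

    by-t : double ≈ e * q′
    by-t = begin
      double
        ≈⟨ sum-cong (λ v → trans (sym (sum-*ˡ _ _)) (sum-cong (λ s →
             solve 3 (λ a b c → a :* (b :* c) := b :* (a :* c)) refl _ _ _))) ⟩
      sum (λ v → sum (λ s → χ X s * (χ (inv Y) (F.1# F.- v) * χ Y (v F.- s))))
        ≈⟨ sum-swap _ ⟩
      sum (λ s → sum (λ v → χ X s * (χ (inv Y) (F.1# F.- v) * χ Y (v F.- s))))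
        ≈⟨ sum-cong (λ s → trans (sum-*ˡ _ _) (trans (*-congˡ (inner s))
             (solve 4 (λ x e d q → x :* (e :* (d :* q :- con (+ 1))) := (d :* x) :* (e :* q) :- x :* e) refl _ e _ q′))) ⟩
      sum (λ s → (⟦ s F.≟ F.1# ⟧ * χ X s) * (e * q′) - χ X s * e)
        ≈⟨ sum-- _ _ ⟩
      sum (λ s → (⟦ s F.≟ F.1# ⟧ * χ X s) * (e * q′)) - sum (λ s → χ X s * e)
        ≈⟨ +-cong (sum-*ʳ _ _) (-‿cong (trans (sum-*ʳ _ _) (*-congʳ ΣX≈0))) ⟩
      sum (λ s → ⟦ s F.≟ F.1# ⟧ * χ X s) * (e * q′) - 0# * e
        ≈⟨ +-congʳ (*-congʳ (trans (sum-unique (λ s → s F.≟ F.1#) F.1# (χ X) (λ p → p) (λ p → p) (λ p → χ-cong X p)) (χ-1 X))) ⟩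
      1# * (e * q′) - 0# * e
        ≈⟨ solve 2 (λ e q → con (+ 1) :* (e :* q) :- con (+ 0) :* e := e :* q) refl e q′ ⟩
      e * q′ ∎

  -- If J(X,Y) ≈ 0, then T = Σ XY equals q, contradicting T² ≈ (q - 1) T.
  jacobi-nonzero : (X Y : Character F K) → sum (χ X) ≈ 0# → sum (χ Y) ≈ 0# → ¬ (jacobi X Y ≈ 0#)
  jacobi-nonzero X Y ΣX≈0 ΣY≈0 j≈0 = *-nonzero q′≉0 1≉0 (begin
    q′ * 1#                       ≈⟨ solve 1 (λ q → q :* con (+ 1) := q :* q :- (q :- con (+ 1)) :* q) refl q′ ⟩
    q′ * q′ - (q′ - 1#) * q′      ≈⟨ +-cong (*-cong q≈T q≈T) (-‿cong (*-congˡ q≈T)) ⟩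
    T * T - (q′ - 1#) * T         ≈⟨ +-congʳ (sum-χ-squared (X ⊗ Y)) ⟩
    (q′ - 1#) * T - (q′ - 1#) * T ≈⟨ -‿inverseʳ _ ⟩
    0#                            ∎)
    where
    T = sum (χ (X ⊗ Y))
    q≈T : q′ ≈ T
    q≈T = difference-zero (*-zero-cancelˡ (χ Y (F.- F.1#)) (χ-nonzero Y -1≉0)
      (trans (sym (jacobi-product X Y ΣX≈0 ΣY≈0)) (trans (*-congʳ j≈0) (zeroˡ _))))

  -- The quadratic character

  IsSquare : F.Carrier → Set (c ⊔ ℓ)
  IsSquare x = Σ F.Carrier λ y → y F.* y F.≈ x

  square? : ∀ x → Dec (IsSquare x)
  square? x with any? (λ y → (y F.* y) F.≟ x) F.elements
  ... | yes found = yes (Any.satisfied found)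
  ... | no none   = no λ (y , y²≈x) → none (Any.map (λ y≈z → F.trans (F.sym (F.*-cong y≈z y≈z)) y²≈x) (F.complete y))

  square-resp : ∀ {x y} → x F.≈ y → IsSquare x → IsSquare y
  square-resp x≈y (r , r²≈x) = r , F.trans r²≈x x≈y

  square-zero : ∀ {x} → x F.≈ F.0# → IsSquare x
  square-zero x≈0 = F.0# , F.trans (F.zeroˡ _) (F.sym x≈0)

  root-zero : ∀ {y} → y F.* y F.≈ F.0# → y F.≈ F.0#
  root-zero {y} y²≈0 with y F.≟ F.0#
  ... | yes y≈0 = y≈0
  ... | no y≉0  = contradiction y²≈0 (F.*-nonzero y≉0 y≉0)

  φ-zero : ∀ {x} → x F.≈ F.0# → φ F K x ≈ 0#
  φ-zero {x} x≈0 with x F.≟ F.0#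
  ... | yes _  = refl
  ... | no x≉0 = contradiction x≈0 x≉0

  φ-square : ∀ {x} → ¬ (x F.≈ F.0#) → IsSquare x → φ F K x ≈ 1#
  φ-square {x} x≉0 (y , y²≈x) with x F.≟ F.0#
  ... | yes x≈0 = contradiction x≈0 x≉0
  ... | no _ with any? (λ y → (y F.* y) F.≟ x) F.elements
  ...   | yes _   = refl
  ...   | no none = contradiction
    (Any.map (λ y≈z → F.trans (F.sym (F.*-cong y≈z y≈z)) y²≈x) (F.complete y)) none

  φ-nonsquare : ∀ {x} → ¬ IsSquare x → φ F K x ≈ - 1#
  φ-nonsquare {x} nonsquare with x F.≟ F.0#
  ... | yes x≈0 = contradiction (square-zero x≈0) nonsquare
  ... | no _ with any? (λ y → (y F.* y) F.≟ x) F.elements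
  ...   | yes found = contradiction (Any.satisfied found) nonsquare
  ...   | no _      = refl

  nonsquare-nonzero : ∀ {x} → ¬ IsSquare x → ¬ (x F.≈ F.0#)
  nonsquare-nonzero nonsquare x≈0 = nonsquare (square-zero x≈0)

  root-indicator : ∀ {x r} → r F.* r F.≈ x → ¬ (r F.≈ F.0#) →
    ∀ y → ⟦ (y F.* y) F.≟ x ⟧ ≈ ⟦ y F.≟ r ⟧ + ⟦ y F.≟ (F.- r) ⟧
  root-indicator {x} {r} r²≈x r≉0 y with y F.≟ r | y F.≟ (F.- r)
  -- The roots r and -r are distinct because 2r is nonzero.
  ... | yes y≈r | yes y≈-r = contradiction
    (F.trans (F.+-congˡ (F.trans (F.sym y≈r) y≈-r)) (F.-‿inverseʳ r)) (F.double-nonzero r≉0)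
  ... | yes y≈r | no _ = trans (⟦⟧-yes ((y F.* y) F.≟ x) (F.trans (F.*-cong y≈r y≈r) r²≈x)) (sym (+-identityʳ _))
  ... | no _ | yes y≈-r = trans (⟦⟧-yes ((y F.* y) F.≟ x) (F.trans (F.*-cong y≈-r y≈-r)
    (F.trans (solveF 1 (λ r → (⊟ r) ⊠ (⊟ r) ⊜ r ⊠ r) F.refl r) r²≈x))) (sym (+-identityˡ _))
  ... | no y≉r | no y≉-r = trans (⟦⟧-no ((y F.* y) F.≟ x) (λ y²≈x →
      F.*-nonzero (F.difference-nonzero y≉r) (F.difference-nonzero y≉-r)
        (F.trans (solveF 2 (λ y r → (y ⊟ r) ⊠ (y ⊟ (⊟ r)) ⊜ y ⊠ y ⊟ r ⊠ r) F.refl y r)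
          (F.trans (F.+-cong y²≈x (F.-‿cong r²≈x)) (F.-‿inverseʳ x))))) (sym (+-identityˡ _))

  sum-roots : ∀ {x r} → r F.* r F.≈ x → ¬ (r F.≈ F.0#) →
    (h : F.Carrier → Carrier) → (∀ {x y} → x F.≈ y → h x ≈ h y) →
    sum (λ y → ⟦ (y F.* y) F.≟ x ⟧ * h y) ≈ h r + h (F.- r)
  sum-roots {x} {r} r²≈x r≉0 h h-cong = begin
    sum (λ y → ⟦ (y F.* y) F.≟ x ⟧ * h y)
      ≈⟨ sum-cong (λ y → trans (*-congʳ (root-indicator r²≈x r≉0 y)) (distribʳ _ _ _)) ⟩
    sum (λ y → ⟦ y F.≟ r ⟧ * h y + ⟦ y F.≟ (F.- r) ⟧ * h y)
      ≈⟨ sum-+ _ _ ⟩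
    sum (λ y → ⟦ y F.≟ r ⟧ * h y) + sum (λ y → ⟦ y F.≟ (F.- r) ⟧ * h y)
      ≈⟨ +-cong (pick r) (pick (F.- r)) ⟩
    h r + h (F.- r) ∎
    where
    pick : ∀ k → sum (λ y → ⟦ y F.≟ k ⟧ * h y) ≈ h k
    pick k = sum-unique (λ y → y F.≟ k) k h (λ p → p) (λ p → p) (λ p → h-cong p)

  roots : F.Carrier → Carrier
  roots x = sum (λ y → ⟦ (y F.* y) F.≟ x ⟧)

  roots-cong : ∀ {x y} → x F.≈ y → roots x ≈ roots y
  roots-cong {x} {y} x≈y = sum-cong (λ r → ⟦⟧-⇔ ((r F.* r) F.≟ x) ((r F.* r) F.≟ y)
    (λ p → F.trans p x≈y) (λ p → F.trans p (F.sym x≈y)))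

  -- Turns φ into a count of square roots; its compatibility with equality and its vanishing sum are
  -- read off from this.
  roots≈1+φ : ∀ x → roots x ≈ 1# + φ F K x
  roots≈1+φ x = by-cases (x F.≟ F.0#) (square? x)
    where
    by-cases : Dec (x F.≈ F.0#) → Dec (IsSquare x) → roots x ≈ 1# + φ F K x
    by-cases (yes x≈0) _ = trans
      (count-unique (λ y → (y F.* y) F.≟ x) F.0# (λ y²≈x → root-zero (F.trans y²≈x x≈0))
        (λ y≈0 → F.trans (F.*-congʳ y≈0) (F.trans (F.zeroˡ _) (F.sym x≈0))))
      (sym (trans (+-congˡ (φ-zero x≈0)) (+-identityʳ 1#)))
    by-cases (no x≉0) (yes (r , r²≈x)) = begin
      roots x                                        ≈⟨ sum-cong (λ _ → sym (*-identityʳ _)) ⟩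
      sum (λ y → ⟦ (y F.* y) F.≟ x ⟧ * 1#)
        ≈⟨ sum-roots r²≈x (λ r≈0 → x≉0 (F.trans (F.sym r²≈x) (F.trans (F.*-congʳ r≈0) (F.zeroˡ _)))) (λ _ → 1#) (λ _ → refl) ⟩
      1# + 1#                                        ≈⟨ +-congˡ (φ-square x≉0 (r , r²≈x)) ⟨
      1# + φ F K x                                   ∎
    by-cases (no _) (no nonsquare) = trans
      (sum-zero (λ y → ⟦⟧-no ((y F.* y) F.≟ x) (λ y²≈x → nonsquare (y , y²≈x))))
      (sym (trans (+-congˡ (φ-nonsquare nonsquare)) (-‿inverseʳ 1#)))

  φ≈roots-1 : ∀ x → φ F K x ≈ roots x - 1#
  φ≈roots-1 x = trans (solve 1 (λ p → p := con (+ 1) :+ p :- con (+ 1)) refl _) (+-congʳ (sym (roots≈1+φ x)))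

  φ-cong : ∀ {x y} → x F.≈ y → φ F K x ≈ φ F K y
  φ-cong {x} {y} x≈y = trans (φ≈roots-1 x) (trans (+-congʳ (roots-cong x≈y)) (sym (φ≈roots-1 y)))

  sum-over-squares : ∀ (k : F.Carrier → Carrier) → (∀ {x y} → x F.≈ y → k x ≈ k y) →
    sum (λ x → k (x F.* x)) ≈ sum (λ t → roots t * k t)
  sum-over-squares k k-cong = begin
    sum (λ x → k (x F.* x))
      ≈⟨ sum-cong (λ x → sum-unique (λ t → (x F.* x) F.≟ t) (x F.* x) k F.sym F.sym (λ p → k-cong (F.sym p))) ⟨
    sum (λ x → sum (λ t → ⟦ (x F.* x) F.≟ t ⟧ * k t))   ≈⟨ sum-swap _ ⟩
    sum (λ t → sum (λ x → ⟦ (x F.* x) F.≟ t ⟧ * k t))   ≈⟨ sum-cong (λ t → sum-*ʳ (k t) _) ⟩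
    sum (λ t → roots t * k t)                           ∎

  sum-φ : sum (φ F K) ≈ 0#
  sum-φ = begin
    sum (φ F K)                                         ≈⟨ sum-cong φ≈roots-1 ⟩
    sum (λ x → roots x - 1#)                            ≈⟨ sum-- _ _ ⟩
    sum roots - sum (λ _ → 1#)                          ≈⟨ +-congʳ (sum-cong (λ _ → *-identityʳ _)) ⟨
    sum (λ x → roots x * 1#) - sum (λ _ → 1#)           ≈⟨ +-congʳ (sum-over-squares (λ _ → 1#) (λ _ → refl)) ⟨
    sum (λ _ → 1#) - sum (λ _ → 1#)                     ≈⟨ -‿inverseʳ _ ⟩
    0#                                                  ∎

  square-* : ∀ {x y} → IsSquare x → IsSquare y → IsSquare (x F.* y)
  square-* (r , r²≈x) (s , s²≈y) = r F.* s ,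
    F.trans (solveF 2 (λ r s → (r ⊠ s) ⊠ (r ⊠ s) ⊜ (r ⊠ r) ⊠ (s ⊠ s)) F.refl r s) (F.*-cong r²≈x s²≈y)

  square-cancel : ∀ {x y} → ¬ (x F.≈ F.0#) → IsSquare x → IsSquare (x F.* y) → IsSquare y
  square-cancel {x} {y} x≉0 (r , r²≈x) (s , s²≈xy) = s F.* r F.⁻¹ ,
    -- The multiplier s²(r r⁻¹ + 1) comes from factoring (r r⁻¹)² - 1 as a difference of squares.
    F.*-cancelˡ x x≉0 (F.modulo (s F.* s F.* (r F.* r F.⁻¹ F.+ F.1#)) (F.inverseʳ r r≉0)
      (F.trans (F.*-congʳ (F.sym r²≈x)) (F.trans
        (solveF 3 (λ r s i → (r ⊠ r) ⊠ ((s ⊠ i) ⊠ (s ⊠ i)) ⊜ s ⊠ s ⊞ (s ⊠ s ⊠ (r ⊠ i ⊞ conF (+ 1))) ⊠ (r ⊠ i ⊟ conF (+ 1)))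
             F.refl r s (r F.⁻¹))
        (F.+-congʳ s²≈xy))))
    where
    r≉0 : ¬ (r F.≈ F.0#)
    r≉0 r≈0 = x≉0 (F.trans (F.sym r²≈x) (F.trans (F.*-congʳ r≈0) (F.zeroˡ _)))

  -- For n a nonsquare, every term of Σ (φ(x) + φ(nx)) ≈ 0 is 0 or -2, the latter exactly when x and nx
  -- are both nonsquares; in characteristic 0 there is no such x.
  nonsquare-* : ∀ {n} → ¬ IsSquare n → ∀ {x} → ¬ IsSquare x → IsSquare (n F.* x)
  nonsquare-* {n} n-nonsquare {x} x-nonsquare with square? (n F.* x)
  ... | yes square = square
  ... | no nx-nonsquare = contradiction (x-nonsquare , nx-nonsquare)
    (count≈0⇒none both? (λ x≈y (p , r) → (λ s → p (square-resp (F.sym x≈y) s)) , (λ s → r (square-resp (F.*-congˡ (F.sym x≈y)) s)))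
      (*-zero-cancelˡ (- (1# + 1#)) (neg-nonzero 2≉0) total) x)
    where
    Both : F.Carrier → Set (c ⊔ ℓ)
    Both x = ¬ IsSquare x × ¬ IsSquare (n F.* x)
    both? : ∀ x → Dec (Both x)
    both? x = ¬? (square? x) ×-dec ¬? (square? (n F.* x))
    n≉0 = nonsquare-nonzero n-nonsquare
    term : ∀ x → φ F K x + φ F K (n F.* x) ≈ - (1# + 1#) * ⟦ both? x ⟧
    term x = by-cases (x F.≟ F.0#) (square? x) (square? (n F.* x))
      where
      absent : ¬ Both x → 0# ≈ - (1# + 1#) * ⟦ both? x ⟧
      absent ¬both = sym (trans (*-congˡ (⟦⟧-no (both? x) ¬both)) (zeroʳ _))
      by-cases : Dec (x F.≈ F.0#) → Dec (IsSquare x) → Dec (IsSquare (n F.* x)) →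
        φ F K x + φ F K (n F.* x) ≈ - (1# + 1#) * ⟦ both? x ⟧
      by-cases (yes x≈0) _ _ = trans
        (+-cong (φ-zero x≈0) (φ-zero (F.trans (F.*-congˡ x≈0) (F.zeroʳ n))))
        (trans (+-identityˡ _) (absent (λ b → proj₁ b (square-zero x≈0))))
      by-cases (no x≉0) (yes sq) (yes nsq) = contradiction
        (square-cancel x≉0 sq (square-resp (F.*-comm n x) nsq)) n-nonsquare
      by-cases (no x≉0) (yes sq) (no nonsq) = trans
        (+-cong (φ-square x≉0 sq) (φ-nonsquare nonsq))
        (trans (-‿inverseʳ 1#) (absent (λ b → proj₁ b sq)))
      by-cases (no x≉0) (no nonsq) (yes nsq) = trans
        (+-cong (φ-nonsquare nonsq) (φ-square (F.*-nonzero n≉0 x≉0) nsq))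
        (trans (-‿inverseˡ 1#) (absent (λ b → proj₂ b nsq)))
      by-cases (no x≉0) (no nonsq) (no nnonsq) = trans
        (+-cong (φ-nonsquare nonsq) (φ-nonsquare nnonsq))
        (trans (solve 0 ((:- con (+ 1)) :+ (:- con (+ 1)) := (:- (con (+ 1) :+ con (+ 1))) :* con (+ 1)) refl)
          (*-congˡ (sym (⟦⟧-yes (both? x) (nonsq , nnonsq)))))
    total : - (1# + 1#) * sum (λ x → ⟦ both? x ⟧) ≈ 0#
    total = begin
      - (1# + 1#) * sum (λ x → ⟦ both? x ⟧)          ≈⟨ sum-*ˡ _ _ ⟨
      sum (λ x → - (1# + 1#) * ⟦ both? x ⟧)          ≈⟨ sum-cong term ⟨
      sum (λ x → φ F K x + φ F K (n F.* x))          ≈⟨ sum-+ _ _ ⟩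
      sum (φ F K) + sum (λ x → φ F K (n F.* x))      ≈⟨ +-congˡ (sum-scale n≉0 (φ F K) φ-cong) ⟩
      sum (φ F K) + sum (φ F K)                      ≈⟨ +-cong sum-φ sum-φ ⟩
      0# + 0#                                        ≈⟨ +-identityˡ 0# ⟩
      0#                                             ∎

  φ-* : ∀ x y → φ F K (x F.* y) ≈ φ F K x * φ F K y
  φ-* x y = by-cases (x F.≟ F.0#) (y F.≟ F.0#) (square? x) (square? y)
    where
    by-cases : Dec (x F.≈ F.0#) → Dec (y F.≈ F.0#) → Dec (IsSquare x) → Dec (IsSquare y) →
      φ F K (x F.* y) ≈ φ F K x * φ F K y
    by-cases (yes x≈0) _ _ _ = trans (φ-zero (F.trans (F.*-congʳ x≈0) (F.zeroˡ y)))
      (sym (trans (*-congʳ (φ-zero x≈0)) (zeroˡ _)))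
    by-cases (no _) (yes y≈0) _ _ = trans (φ-zero (F.trans (F.*-congˡ y≈0) (F.zeroʳ x)))
      (sym (trans (*-congˡ (φ-zero y≈0)) (zeroʳ _)))
    by-cases (no x≉0) (no y≉0) (yes sx) (yes sy) = trans (φ-square (F.*-nonzero x≉0 y≉0) (square-* sx sy))
      (sym (trans (*-cong (φ-square x≉0 sx) (φ-square y≉0 sy)) (*-identityˡ 1#)))
    by-cases (no x≉0) (no y≉0) (yes sx) (no ny) = trans
      (φ-nonsquare (λ sxy → ny (square-cancel x≉0 sx sxy)))
      (sym (trans (*-cong (φ-square x≉0 sx) (φ-nonsquare ny)) (*-identityˡ _)))
    by-cases (no x≉0) (no y≉0) (no nx) (yes sy) = trans
      (φ-nonsquare (λ sxy → nx (square-cancel y≉0 sy (square-resp (F.*-comm x y) sxy))))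
      (sym (trans (*-cong (φ-nonsquare nx) (φ-square y≉0 sy)) (*-identityʳ _)))
    by-cases (no x≉0) (no y≉0) (no nx) (no ny) = trans
      (φ-square (F.*-nonzero x≉0 y≉0) (nonsquare-* nx ny))
      (sym (trans (*-cong (φ-nonsquare nx) (φ-nonsquare ny))
        (solve 0 ((:- con (+ 1)) :* (:- con (+ 1)) := con (+ 1)) refl)))

  Φ : Character F K
  Φ = record
    { χ      = φ F K
    ; χ-cong = φ-cong
    ; χ-0    = φ-zero F.refl
    ; χ-1    = φ-square F.1≉0 (F.1# , F.*-identityˡ F.1#)
    ; χ-*    = φ-*
    }

  φ-of-square : ∀ {x} → ¬ (x F.≈ F.0#) → φ F K (x F.* x) ≈ 1#
  φ-of-square {x} x≉0 = φ-square (F.*-nonzero x≉0 x≉0) (x , F.refl)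

  φ-squared : ∀ {x} → ¬ (x F.≈ F.0#) → φ F K x * φ F K x ≈ 1#
  φ-squared x≉0 = trans (sym (φ-* _ _)) (φ-of-square x≉0)

  -- 4y(1 - y) = 1 - u² for u = 2y - 1.
  jacobi-diagonal : (B : Character F K) → sum (χ B) ≈ 0# →
    χ B (F.2# F.* F.2#) * jacobi B B ≈ jacobi Φ B
  jacobi-diagonal B ΣB≈0 = begin
    χ B (F.2# F.* F.2#) * jacobi B B
      ≈⟨ sum-*ˡ _ _ ⟨
    sum (λ y → χ B (F.2# F.* F.2#) * (χ B y * χ B (F.1# F.- y)))
      ≈⟨ sum-cong term ⟩
    sum (λ y → χ B (F.1# F.- (F.2# F.* y F.- F.1#) F.* (F.2# F.* y F.- F.1#)))
      ≈⟨ sum-affine F.1# (λ u → χ B (F.1# F.- u F.* u)) (λ p → χ-cong B (F.+-congˡ (F.-‿cong (F.*-cong p p)))) ⟩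
    sum (λ u → χ B (F.1# F.- u F.* u))
      ≈⟨ sum-over-squares (λ t → χ B (F.1# F.- t)) (λ p → χ-cong B (F.+-congˡ (F.-‿cong p))) ⟩
    sum (λ t → roots t * χ B (F.1# F.- t))
      ≈⟨ sum-cong (λ t → trans (*-congʳ (roots≈1+φ t)) (solve 2 (λ p b → (con (+ 1) :+ p) :* b := b :+ p :* b) refl _ _)) ⟩
    sum (λ t → χ B (F.1# F.- t) + φ F K t * χ B (F.1# F.- t))
      ≈⟨ sum-+ _ _ ⟩
    sum (λ t → χ B (F.1# F.- t)) + jacobi Φ B
      ≈⟨ +-congʳ (trans (sum-reflect F.1# (χ B) (χ-cong B)) ΣB≈0) ⟩
    0# + jacobi Φ B  ≈⟨ +-identityˡ _ ⟩
    jacobi Φ B       ∎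
    where
    term : ∀ y → χ B (F.2# F.* F.2#) * (χ B y * χ B (F.1# F.- y))
      ≈ χ B (F.1# F.- (F.2# F.* y F.- F.1#) F.* (F.2# F.* y F.- F.1#))
    term y = begin
      χ B (F.2# F.* F.2#) * (χ B y * χ B (F.1# F.- y))   ≈⟨ *-congˡ (χ-* B _ _) ⟨
      χ B (F.2# F.* F.2#) * χ B (y F.* (F.1# F.- y))     ≈⟨ χ-* B _ _ ⟨
      χ B (F.2# F.* F.2# F.* (y F.* (F.1# F.- y)))
        ≈⟨ χ-cong B (solveF 1 (λ y → let one = conF (+ 1); t = one ⊞ one in
             t ⊠ t ⊠ (y ⊠ (one ⊟ y)) ⊜ one ⊟ (t ⊠ y ⊟ one) ⊠ (t ⊠ y ⊟ one)) F.refl y) ⟩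
      χ B (F.1# F.- (F.2# F.* y F.- F.1#) F.* (F.2# F.* y F.- F.1#)) ∎

  -- The inner sum over s

  -- The sum of φ over the fibre of s ↦ s + n/s above T, with the denominator cleared. Clearing it
  -- can add only the point s ≈ 0, where φ vanishes.
  rootSum : F.Carrier → F.Carrier → Carrier
  rootSum n T = sum (λ s → ⟦ (s F.* s F.+ n) F.≟ (T F.* s) ⟧ * φ F K s)

  -- If s² + e² = Ts then s(T + 2e) = (s + e)², so φ takes the value φ(T + 2e) at every root;
  -- the number of roots is 1 + φ(T² - 4e²).
  rootSum-nondegenerate : ∀ {n e} T → e F.* e F.≈ n → ¬ (e F.≈ F.0#) → ¬ (T F.+ (e F.+ e) F.≈ F.0#) →
    rootSum n T ≈ φ F K (T F.+ (e F.+ e)) + φ F K (T F.+ (F.- e F.+ F.- e))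
  rootSum-nondegenerate {n} {e} T e²≈n e≉0 P≉0 = begin
    rootSum n T
      ≈⟨ sum-cong (λ s → ⟦⟧-*-cong ((s F.* s F.+ n) F.≟ (T F.* s)) (root-value s)) ⟩
    sum (λ s → ⟦ (s F.* s F.+ n) F.≟ (T F.* s) ⟧ * φ F K P)
      ≈⟨ sum-*ʳ _ _ ⟩
    sum (λ s → ⟦ (s F.* s F.+ n) F.≟ (T F.* s) ⟧) * φ F K P
      ≈⟨ *-congʳ number-of-roots ⟩
    roots (P F.* Q) * φ F K P
      ≈⟨ *-congʳ (trans (roots≈1+φ _) (+-congˡ (φ-* P Q))) ⟩
    (1# + φ F K P * φ F K Q) * φ F K P
      ≈⟨ solve 2 (λ p q → (con (+ 1) :+ p :* q) :* p := p :+ (p :* p) :* q) refl _ _ ⟩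
    φ F K P + (φ F K P * φ F K P) * φ F K Q
      ≈⟨ +-congˡ (trans (*-congʳ (φ-squared P≉0)) (*-identityˡ _)) ⟩
    φ F K P + φ F K Q ∎
    where
    P = T F.+ (e F.+ e)
    Q = T F.+ (F.- e F.+ F.- e)
    root-value : ∀ s → s F.* s F.+ n F.≈ T F.* s → φ F K s ≈ φ F K P
    root-value s root = begin
      φ F K s                          ≈⟨ *-identityʳ _ ⟨
      φ F K s * 1#                     ≈⟨ *-congˡ (φ-squared P≉0) ⟨
      φ F K s * (φ F K P * φ F K P)    ≈⟨ *-assoc _ _ _ ⟨
      φ F K s * φ F K P * φ F K P      ≈⟨ *-congʳ (φ-* s P) ⟨
      φ F K (s F.* P) * φ F K P        ≈⟨ *-congʳ (trans (φ-cong sP≈[s+e]²) (φ-of-square s+e≉0)) ⟩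
      1# * φ F K P                     ≈⟨ *-identityˡ _ ⟩
      φ F K P                          ∎
      where
      sP≈[s+e]² : s F.* P F.≈ (s F.+ e) F.* (s F.+ e)
      sP≈[s+e]² = F.modulo (F.- F.1#) (F.trans (F.+-congˡ e²≈n) root)
        (solveF 3 (λ s T e → s ⊠ (T ⊞ (e ⊞ e)) ⊜ (s ⊞ e) ⊠ (s ⊞ e) ⊞ (⊟ conF (+ 1)) ⊠ ((s ⊠ s ⊞ e ⊠ e) ⊟ T ⊠ s))
             F.refl s T e)
      s≉0 : ¬ (s F.≈ F.0#)
      s≉0 s≈0 = F.*-nonzero e≉0 e≉0 (F.modulo F.1# (F.trans (F.+-congˡ e²≈n) root)
        (F.trans (solveF 3 (λ s T e → e ⊠ e ⊜ s ⊠ (T ⊟ s) ⊞ conF (+ 1) ⊠ ((s ⊠ s ⊞ e ⊠ e) ⊟ T ⊠ s)) F.refl s T e)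
          (F.+-congʳ (F.trans (F.*-congʳ s≈0) (F.zeroˡ _)))))
      s+e≉0 : ¬ (s F.+ e F.≈ F.0#)
      s+e≉0 p = F.*-nonzero s≉0 P≉0 (F.trans sP≈[s+e]² (F.trans (F.*-congʳ p) (F.zeroˡ _)))
    number-of-roots : sum (λ s → ⟦ (s F.* s F.+ n) F.≟ (T F.* s) ⟧) ≈ roots (P F.* Q)
    number-of-roots = trans
      (sum-cong (λ s → ⟦⟧-⇔ ((s F.* s F.+ n) F.≟ (T F.* s)) (((F.2# F.* s F.- T) F.* (F.2# F.* s F.- T)) F.≟ (P F.* Q))
        (λ root → F.modulo (F.2# F.* F.2#) (F.trans (F.+-congˡ e²≈n) root) (completed s))
        (λ sq → F.modulo F.1# (F.*-cancelˡ (F.2# F.* F.2#) (F.*-nonzero F.2≉0 F.2≉0)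
            (F.trans (F.modulo F.1# sq (uncompleted s)) (F.sym (F.zeroʳ _))))
          (F.trans (F.+-congˡ (F.sym e²≈n)) (solveF 3 (λ s T e →
            s ⊠ s ⊞ e ⊠ e ⊜ T ⊠ s ⊞ conF (+ 1) ⊠ (((s ⊠ s ⊞ e ⊠ e) ⊟ T ⊠ s) ⊟ conF (+ 0))) F.refl s T e)))))
      (sum-affine T (λ y → ⟦ (y F.* y) F.≟ (P F.* Q) ⟧) (λ {x} {y} p → ⟦⟧-⇔ ((x F.* x) F.≟ (P F.* Q)) ((y F.* y) F.≟ (P F.* Q))
        (λ r → F.trans (F.sym (F.*-cong p p)) r) (λ r → F.trans (F.*-cong p p) r)))
      where
      completed : ∀ s → (F.2# F.* s F.- T) F.* (F.2# F.* s F.- T)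
        F.≈ P F.* Q F.+ F.2# F.* F.2# F.* ((s F.* s F.+ e F.* e) F.- T F.* s)
      completed s = solveF 3 (λ s T e → let t = conF (+ 1) ⊞ conF (+ 1) in
        (t ⊠ s ⊟ T) ⊠ (t ⊠ s ⊟ T) ⊜ (T ⊞ (e ⊞ e)) ⊠ (T ⊞ ((⊟ e) ⊞ (⊟ e))) ⊞ t ⊠ t ⊠ ((s ⊠ s ⊞ e ⊠ e) ⊟ T ⊠ s)) F.refl s T e
      uncompleted : ∀ s → F.2# F.* F.2# F.* ((s F.* s F.+ e F.* e) F.- T F.* s)
        F.≈ F.0# F.+ F.1# F.* ((F.2# F.* s F.- T) F.* (F.2# F.* s F.- T) F.- P F.* Q)
      uncompleted s = solveF 3 (λ s T e → let t = conF (+ 1) ⊞ conF (+ 1) in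
        t ⊠ t ⊠ ((s ⊠ s ⊞ e ⊠ e) ⊟ T ⊠ s) ⊜ conF (+ 0) ⊞ conF (+ 1) ⊠ ((t ⊠ s ⊟ T) ⊠ (t ⊠ s ⊟ T) ⊟ (T ⊞ (e ⊞ e)) ⊠ (T ⊞ ((⊟ e) ⊞ (⊟ e)))))
             F.refl s T e

  -- For n a nonsquare the two roots s and T - s have product n, so their φ-values cancel.
  rootSum-nonsquare : ∀ {n} T → ¬ IsSquare n → rootSum n T ≈ 0#
  rootSum-nonsquare {n} T nonsquare = *-zero-cancelˡ (1# + 1#) 2≉0 (begin
    (1# + 1#) * rootSum n T        ≈⟨ solve 1 (λ m → (con (+ 1) :+ con (+ 1)) :* m := m :+ m) refl _ ⟩
    rootSum n T + rootSum n T      ≈⟨ +-congˡ antisymmetric ⟩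
    rootSum n T - rootSum n T      ≈⟨ -‿inverseʳ _ ⟩
    0#                             ∎)
    where
    Root? : ∀ s → Dec (s F.* s F.+ n F.≈ T F.* s)
    Root? s = (s F.* s F.+ n) F.≟ (T F.* s)
    Root?-cong : ∀ {x y} → x F.≈ y → ⟦ Root? x ⟧ ≈ ⟦ Root? y ⟧
    Root?-cong {x} {y} p = ⟦⟧-⇔ (Root? x) (Root? y)
      (λ r → F.trans (F.+-congʳ (F.*-cong (F.sym p) (F.sym p))) (F.trans r (F.*-congˡ p)))
      (λ r → F.trans (F.+-congʳ (F.*-cong p p)) (F.trans r (F.*-congˡ (F.sym p))))
    reflected : ∀ s → ⟦ Root? (T F.- s) ⟧ ≈ ⟦ Root? s ⟧
    reflected s = ⟦⟧-⇔ (Root? (T F.- s)) (Root? s)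
      (λ r → F.modulo F.1# r (solveF 3 (λ s T n → s ⊠ s ⊞ n ⊜ T ⊠ s ⊞ conF (+ 1) ⊠ (((T ⊟ s) ⊠ (T ⊟ s) ⊞ n) ⊟ T ⊠ (T ⊟ s)))
           F.refl s T n))
      (λ r → F.modulo F.1# r (solveF 3 (λ s T n → (T ⊟ s) ⊠ (T ⊟ s) ⊞ n ⊜ T ⊠ (T ⊟ s) ⊞ conF (+ 1) ⊠ (s ⊠ s ⊞ n ⊟ T ⊠ s))
           F.refl s T n))
    opposite : ∀ s → s F.* s F.+ n F.≈ T F.* s → φ F K (T F.- s) ≈ - φ F K s
    opposite s root = begin
      φ F K (T F.- s)                          ≈⟨ *-identityˡ _ ⟨
      1# * φ F K (T F.- s)                     ≈⟨ *-congʳ (φ-squared s≉0) ⟨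
      φ F K s * φ F K s * φ F K (T F.- s)      ≈⟨ *-assoc _ _ _ ⟩
      φ F K s * (φ F K s * φ F K (T F.- s))    ≈⟨ *-congˡ (φ-* _ _) ⟨
      φ F K s * φ F K (s F.* (T F.- s))        ≈⟨ *-congˡ (trans (φ-cong product) (φ-nonsquare nonsquare)) ⟩
      φ F K s * - 1#                           ≈⟨ solve 1 (λ s → s :* (:- con (+ 1)) := :- s) refl _ ⟩
      - φ F K s                                ∎
      where
      product : s F.* (T F.- s) F.≈ n
      product = F.modulo (F.- F.1#) root
        (solveF 3 (λ s T n → s ⊠ (T ⊟ s) ⊜ n ⊞ (⊟ conF (+ 1)) ⊠ ((s ⊠ s ⊞ n) ⊟ T ⊠ s)) F.refl s T n)
      s≉0 : ¬ (s F.≈ F.0#)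
      s≉0 s≈0 = nonsquare-nonzero nonsquare (F.trans (F.sym product) (F.trans (F.*-congʳ s≈0) (F.zeroˡ _)))
    antisymmetric : rootSum n T ≈ - rootSum n T
    antisymmetric = begin
      rootSum n T
        ≈⟨ sum-reflect T (λ s → ⟦ Root? s ⟧ * φ F K s) (λ p → *-cong (Root?-cong p) (φ-cong p)) ⟨
      sum (λ s → ⟦ Root? (T F.- s) ⟧ * φ F K (T F.- s))
        ≈⟨ sum-cong (λ s → trans (*-congʳ (reflected s)) (⟦⟧-*-cong (Root? s) (opposite s))) ⟩
      sum (λ s → ⟦ Root? s ⟧ * - φ F K s)
        ≈⟨ sum-cong (λ s → solve 2 (λ r p → r :* (:- p) := :- (r :* p)) refl _ _) ⟩
      sum (λ s → - (⟦ Root? s ⟧ * φ F K s))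
        ≈⟨ sum-neg _ ⟩
      - rootSum n T ∎

  -- The roots are 0 and T, and the root 0 contributes φ(0) = 0.
  rootSum-zero : ∀ {n} T → n F.≈ F.0# → rootSum n T ≈ φ F K T
  rootSum-zero {n} T n≈0 = trans (sum-cong pointwise)
    (sum-unique (λ s → s F.≟ T) T (φ F K) (λ p → p) (λ p → p) (λ p → φ-cong p))
    where
    pointwise : ∀ s → ⟦ (s F.* s F.+ n) F.≟ (T F.* s) ⟧ * φ F K s ≈ ⟦ s F.≟ T ⟧ * φ F K s
    pointwise s = by-cases (s F.≟ F.0#)
      where
      s²+n≈s² : s F.* s F.+ n F.≈ s F.* s
      s²+n≈s² = F.trans (F.+-congˡ n≈0) (F.+-identityʳ _)
      by-cases : Dec (s F.≈ F.0#) → ⟦ (s F.* s F.+ n) F.≟ (T F.* s) ⟧ * φ F K s ≈ ⟦ s F.≟ T ⟧ * φ F K s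
      by-cases (yes s≈0) = trans (trans (*-congˡ (φ-zero s≈0)) (zeroʳ _)) (sym (trans (*-congˡ (φ-zero s≈0)) (zeroʳ _)))
      by-cases (no s≉0)  = *-congʳ (⟦⟧-⇔ ((s F.* s F.+ n) F.≟ (T F.* s)) (s F.≟ T)
        (λ root → F.*-cancelˡ s s≉0 (F.trans (F.sym s²+n≈s²) (F.trans root (F.*-comm T s))))
        (λ s≈T → F.trans s²+n≈s² (F.*-congʳ s≈T)))

  φ-shift-cong : ∀ T {x y} → x F.≈ y → φ F K (T F.+ (x F.+ x)) ≈ φ F K (T F.+ (y F.+ y))
  φ-shift-cong T p = φ-cong (F.+-congˡ (F.+-cong p p))

  -- The sum over e has no term, one term or two according as n is a nonsquare, zero or a nonzero
  -- square, which makes one formula out of the three evaluations of `rootSum`.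
  rootSum-value : ∀ n T → rootSum n T ≈ sum (λ e → ⟦ (e F.* e) F.≟ n ⟧ * φ F K (T F.+ (e F.+ e)))
  rootSum-value n T with square? n
  ... | no nonsquare = trans (rootSum-nonsquare T nonsquare) (sym (sum-zero (λ e →
    trans (*-congʳ (⟦⟧-no ((e F.* e) F.≟ n) (λ e²≈n → nonsquare (e , e²≈n)))) (zeroˡ _))))
  ... | yes (e , e²≈n) with e F.≟ F.0#
  ...   | yes e≈0 = trans (rootSum-zero T n≈0) (sym (trans
    (sum-unique (λ e → (e F.* e) F.≟ n) F.0# (λ e → φ F K (T F.+ (e F.+ e)))
      only-zero zero-is-root (λ r → φ-shift-cong T (only-zero r)))
    (φ-cong (solveF 1 (λ T → T ⊞ (conF (+ 0) ⊞ conF (+ 0)) ⊜ T) F.refl T))))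
    where
    n≈0 : n F.≈ F.0#
    n≈0 = F.trans (F.sym e²≈n) (F.trans (F.*-congʳ e≈0) (F.zeroˡ _))
    only-zero : ∀ {x} → x F.* x F.≈ n → x F.≈ F.0#
    only-zero r = root-zero (F.trans r n≈0)
    zero-is-root : ∀ {x} → x F.≈ F.0# → x F.* x F.≈ n
    zero-is-root p = F.trans (F.*-congʳ p) (F.trans (F.zeroˡ _) (F.sym n≈0))
  ...   | no e≉0 = trans (by-cases ((T F.+ (e F.+ e)) F.≟ F.0#))
    (sym (sum-roots e²≈n e≉0 (λ e → φ F K (T F.+ (e F.+ e))) (φ-shift-cong T)))
    where
    by-cases : Dec (T F.+ (e F.+ e) F.≈ F.0#) →
      rootSum n T ≈ φ F K (T F.+ (e F.+ e)) + φ F K (T F.+ (F.- e F.+ F.- e))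
    by-cases (no P≉0)  = rootSum-nondegenerate T e²≈n e≉0 P≉0
    -- If T + 2e vanishes, use the root -e instead: T + 2e and T - 2e differ by 4e, so they are not
    -- both zero.
    by-cases (yes P≈0) = trans
      (rootSum-nondegenerate T (F.trans (solveF 1 (λ e → (⊟ e) ⊠ (⊟ e) ⊜ e ⊠ e) F.refl e) e²≈n) (F.neg-nonzero e≉0) Q≉0)
      (trans (+-comm _ _) (+-congʳ (φ-shift-cong T (solveF 1 (λ e → ⊟ (⊟ e) ⊜ e) F.refl e))))
      where
      Q≉0 : ¬ (T F.+ (F.- e F.+ F.- e) F.≈ F.0#)
      Q≉0 Q≈0 = F.double-nonzero (F.double-nonzero e≉0)
        (F.trans (solveF 2 (λ T e → (e ⊞ e) ⊞ (e ⊞ e) ⊜ (T ⊞ (e ⊞ e)) ⊟ (T ⊞ ((⊟ e) ⊞ (⊟ e)))) F.refl T e)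
          (F.trans (F.+-cong P≈0 (F.-‿cong Q≈0)) (F.-‿inverseʳ F.0#)))

  -- Grouping by T = s + n/s leaves, for each root e, a convolution of φ and B at β + 2e. It is a
  -- multiple of J(φ,B) only at a nonzero point; since (β + 2e)(β - 2e) = β² - 4n, the hypothesis
  -- guarantees this for every root.
  quadratic-kernel : (B : Character F K) → ∀ n β → ¬ (β F.* β F.≈ (n F.+ n) F.+ (n F.+ n)) →
    sum (λ s → χ (inv B ⊗ Φ) s * χ B (β F.* s F.- (s F.* s F.+ n)))
      ≈ jacobi Φ B * sum (λ e → ⟦ (e F.* e) F.≟ n ⟧ * χ (Φ ⊗ B) (β F.+ (e F.+ e)))
  quadratic-kernel B n β disc≉0 = begin
    sum (λ s → χ (inv B ⊗ Φ) s * χ B (β F.* s F.- (s F.* s F.+ n)))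
      ≈⟨ sum-cong trace ⟩
    sum (λ s → sum (λ T → ⟦ Root? s T ⟧ * (φ F K s * χ B (β F.- T))))
      ≈⟨ sum-swap _ ⟩
    sum (λ T → sum (λ s → ⟦ Root? s T ⟧ * (φ F K s * χ B (β F.- T))))
      ≈⟨ sum-cong (λ T → trans (sum-cong (λ s → sym (*-assoc _ _ _))) (trans (sum-*ʳ _ _) (*-congʳ (rootSum-value n T)))) ⟩
    sum (λ T → sum (λ e → ⟦ (e F.* e) F.≟ n ⟧ * φ F K (T F.+ (e F.+ e))) * χ B (β F.- T))
      ≈⟨ sum-cong (λ T → trans (sym (sum-*ʳ _ _)) (sum-cong (λ e → *-assoc _ _ _))) ⟩
    sum (λ T → sum (λ e → ⟦ (e F.* e) F.≟ n ⟧ * (φ F K (T F.+ (e F.+ e)) * χ B (β F.- T))))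
      ≈⟨ sum-swap _ ⟩
    sum (λ e → sum (λ T → ⟦ (e F.* e) F.≟ n ⟧ * (φ F K (T F.+ (e F.+ e)) * χ B (β F.- T))))
      ≈⟨ sum-cong (λ e → trans (sum-*ˡ _ _) (*-congˡ (shift e))) ⟩
    sum (λ e → ⟦ (e F.* e) F.≟ n ⟧ * convolution Φ B (β F.+ (e F.+ e)))
      ≈⟨ sum-cong (λ e → trans (⟦⟧-*-cong ((e F.* e) F.≟ n) (λ e²≈n → convolution-nonzero Φ B (D≉0 e e²≈n)))
           (solve 3 (λ d p j → d :* (p :* j) := j :* (d :* p)) refl _ _ _)) ⟩
    sum (λ e → jacobi Φ B * (⟦ (e F.* e) F.≟ n ⟧ * χ (Φ ⊗ B) (β F.+ (e F.+ e))))
      ≈⟨ sum-*ˡ _ _ ⟩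
    jacobi Φ B * sum (λ e → ⟦ (e F.* e) F.≟ n ⟧ * χ (Φ ⊗ B) (β F.+ (e F.+ e))) ∎
    where
    Root? : ∀ s T → Dec (s F.* s F.+ n F.≈ T F.* s)
    Root? s T = (s F.* s F.+ n) F.≟ (T F.* s)
    D≉0 : ∀ e → e F.* e F.≈ n → ¬ (β F.+ (e F.+ e) F.≈ F.0#)
    D≉0 e e²≈n D≈0 = disc≉0 (F.trans
      (F.modulo (β F.- (e F.+ e)) D≈0 (solveF 2 (λ β e → β ⊠ β ⊜ (e ⊠ e ⊞ e ⊠ e) ⊞ (e ⊠ e ⊞ e ⊠ e) ⊞ (β ⊟ (e ⊞ e)) ⊠ (β ⊞ (e ⊞ e) ⊟ conF (+ 0)))
           F.refl β e))
      (F.+-cong (F.+-cong e²≈n e²≈n) (F.+-cong e²≈n e²≈n)))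
    trace : ∀ s → χ (inv B ⊗ Φ) s * χ B (β F.* s F.- (s F.* s F.+ n))
      ≈ sum (λ T → ⟦ Root? s T ⟧ * (φ F K s * χ B (β F.- T)))
    trace s = by-cases (s F.≟ F.0#)
      where
      by-cases : Dec (s F.≈ F.0#) → χ (inv B ⊗ Φ) s * χ B (β F.* s F.- (s F.* s F.+ n))
        ≈ sum (λ T → ⟦ Root? s T ⟧ * (φ F K s * χ B (β F.- T)))
      by-cases (yes s≈0) = trans (trans (*-congʳ (χ-zero (inv B ⊗ Φ) s≈0)) (zeroˡ _)) (sym (sum-zero (λ T →
        trans (*-congˡ (trans (*-congʳ (φ-zero s≈0)) (zeroˡ _))) (zeroʳ _))))
      by-cases (no s≉0) = trans (begin
        χ B s ⁻¹ * φ F K s * χ B (β F.* s F.- (s F.* s F.+ n))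
          ≈⟨ *-congˡ (trans (χ-cong B factor) (χ-* B _ _)) ⟩
        χ B s ⁻¹ * φ F K s * (χ B s * χ B (β F.- T₀))
          ≈⟨ solve 4 (λ i p b d → i :* p :* (b :* d) := (b :* i) :* (p :* d)) refl _ _ _ _ ⟩
        (χ B s * χ B s ⁻¹) * (φ F K s * χ B (β F.- T₀))
          ≈⟨ trans (*-congʳ (χ⁻¹-inverse B s≉0)) (*-identityˡ _) ⟩
        φ F K s * χ B (β F.- T₀) ∎)
        (sym (sum-unique (Root? s) T₀ (λ T → φ F K s * χ B (β F.- T)) is-T₀
          (λ T≈T₀ → F.trans (F.sym T₀s) (F.*-congʳ (F.sym T≈T₀)))
          (λ root → *-congˡ (χ-cong B (F.+-congˡ (F.-‿cong (is-T₀ root)))))))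
        where
        T₀ = (s F.* s F.+ n) F.* s F.⁻¹
        T₀s : T₀ F.* s F.≈ s F.* s F.+ n
        T₀s = F.trans (F.*-assoc _ _ _) (F.trans (F.*-congˡ (F.inverseˡ s s≉0)) (F.*-identityʳ _))
        is-T₀ : ∀ {T} → s F.* s F.+ n F.≈ T F.* s → T F.≈ T₀
        is-T₀ root = F.*-cancelˡ s s≉0 (F.trans (F.*-comm _ _) (F.trans (F.sym root) (F.trans (F.sym T₀s) (F.*-comm _ _))))
        factor : β F.* s F.- (s F.* s F.+ n) F.≈ s F.* (β F.- T₀)
        factor = F.modulo F.1# T₀s (solveF 4 (λ β s m T → β ⊠ s ⊟ m ⊜ s ⊠ (β ⊟ T) ⊞ conF (+ 1) ⊠ (T ⊠ s ⊟ m))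
             F.refl β s (s F.* s F.+ n) T₀)
    shift : ∀ e → sum (λ T → φ F K (T F.+ (e F.+ e)) * χ B (β F.- T)) ≈ convolution Φ B (β F.+ (e F.+ e))
    shift e = trans
      (sum-cong (λ T → *-cong
        (φ-cong (solveF 2 (λ T e → T ⊞ (e ⊞ e) ⊜ T ⊟ (⊟ (e ⊞ e))) F.refl T e))
        (χ-cong B (solveF 3 (λ β T e → β ⊟ T ⊜ (β ⊞ (e ⊞ e)) ⊟ (T ⊟ (⊟ (e ⊞ e)))) F.refl β T e))))
      (sum-translate (F.- (e F.+ e)) (λ τ → φ F K τ * χ B ((β F.+ (e F.+ e)) F.- τ))
        (λ p → *-cong (φ-cong p) (χ-cong B (F.+-congˡ (F.-‿cong p)))))

-- The characters X and Y, the kernel expansion and the conic.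

module Transformation {c ℓ c′ ℓ′} (F : FiniteField c ℓ) (odd : FiniteField.q F % 2 ≡ 1)
  (K : Field c′ ℓ′) (char0 : CharZero K) (A B : Character F K) where
  open CharacterSums F odd K char0 public
  open Field K
  open FieldProperties K
  open IntegerSolver commutativeRing
  open SetoidReasoning setoid
  open Character

  -- `Y` is the second parameter on the right-hand side and `X` is the character paired with it
  -- there, Ȳ times Bφ. The later steps rest on the relations YX = Bφ and Y²X = A.
  X Y : Character F K
  X = B ⊗ B ⊗ inv A
  Y = A ⊗ Φ ⊗ inv B

  χ-⁻¹ : (Z : Character F K) → ∀ x → χ Z (x F.⁻¹) ≈ χ Z x ⁻¹
  χ-⁻¹ Z x with x F.≟ F.0#
  ... | yes x≈0 = trans (χ-zero Z (F.trans (F.⁻¹-cong x≈0) F.0⁻¹≈0)) (sym (χ⁻¹-zero Z x≈0))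
  ... | no x≉0  = inverse-unique _ (χ-unit Z x≉0)

  sum-inv : (Z : Character F K) → sum (χ (inv Z)) ≈ sum (χ Z)
  sum-inv Z = sum-bijection F._⁻¹ F._⁻¹ F.⁻¹-cong F.⁻¹-cong involutive involutive
    (χ (inv Z)) (χ Z) (χ-cong Z) (λ x → sym (χ-⁻¹ Z x))
    where
    involutive : ∀ x → (x F.⁻¹) F.⁻¹ F.≈ x
    involutive x with x F.≟ F.0#
    ... | yes x≈0 = F.trans (F.⁻¹-cong (F.trans (F.⁻¹-cong x≈0) F.0⁻¹≈0)) (F.trans F.0⁻¹≈0 (F.sym x≈0))
    ... | no x≉0  = F.sym (F.inverse-unique (x F.⁻¹) (F.inverseˡ x x≉0))

  Y*X : ∀ {x} → ¬ (x F.≈ F.0#) → χ Y x * χ X x ≈ χ B x * φ F K x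
  Y*X {x} x≉0 = begin
    χ A x * φ F K x * χ B x ⁻¹ * (χ B x * χ B x * χ A x ⁻¹)
      ≈⟨ solve 5 (λ a p b′ b a′ → a :* p :* b′ :* (b :* b :* a′) := (a :* a′) :* (b :* b′) :* (b :* p)) refl _ _ _ _ _ ⟩
    (χ A x * χ A x ⁻¹) * (χ B x * χ B x ⁻¹) * (χ B x * φ F K x)
      ≈⟨ *-congʳ (trans (*-cong (χ⁻¹-inverse A x≉0) (χ⁻¹-inverse B x≉0)) (*-identityˡ 1#)) ⟩
    1# * (χ B x * φ F K x)  ≈⟨ *-identityˡ _ ⟩
    χ B x * φ F K x         ∎

  Y²*X : ∀ {x} → ¬ (x F.≈ F.0#) → χ Y x * (χ Y x * χ X x) ≈ χ A x
  Y²*X {x} x≉0 = begin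
    χ Y x * (χ Y x * χ X x)                            ≈⟨ *-congˡ (Y*X x≉0) ⟩
    χ A x * φ F K x * χ B x ⁻¹ * (χ B x * φ F K x)
      ≈⟨ solve 4 (λ a p b′ b → a :* p :* b′ :* (b :* p) := a :* ((p :* p) :* (b :* b′))) refl _ _ _ _ ⟩
    χ A x * ((φ F K x * φ F K x) * (χ B x * χ B x ⁻¹))
      ≈⟨ *-congˡ (trans (*-cong (φ-squared x≉0) (χ⁻¹-inverse B x≉0)) (*-identityˡ 1#)) ⟩
    χ A x * 1#                                         ≈⟨ *-identityʳ _ ⟩
    χ A x                                              ∎

  X-conj : ∀ x → χ (inv Y ⊗ (B ⊗ Φ)) x ≈ χ X x
  X-conj x = by-cases (x F.≟ F.0#)
    where
    by-cases : Dec (x F.≈ F.0#) → χ (inv Y ⊗ (B ⊗ Φ)) x ≈ χ X x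
    by-cases (yes x≈0) = trans (χ-zero (inv Y ⊗ (B ⊗ Φ)) x≈0) (sym (χ-zero X x≈0))
    by-cases (no x≉0)  = begin
      χ Y x ⁻¹ * (χ B x * φ F K x)   ≈⟨ *-congˡ (Y*X x≉0) ⟨
      χ Y x ⁻¹ * (χ Y x * χ X x)     ≈⟨ solve 3 (λ i y x → i :* (y :* x) := (y :* i) :* x) refl _ _ _ ⟩
      (χ Y x * χ Y x ⁻¹) * χ X x     ≈⟨ trans (*-congʳ (χ⁻¹-inverse Y x≉0)) (*-identityˡ _) ⟩
      χ X x                          ∎

  φ-⁻¹ : ∀ {x} → ¬ (x F.≈ F.0#) → φ F K (x F.⁻¹) ≈ φ F K x
  φ-⁻¹ {x} x≉0 = trans (χ-⁻¹ Φ x) (sym (inverse-unique _ (φ-squared x≉0)))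

  J₂ : Carrier
  J₂ = jacobi Y X

  -- The convolution of B̄φ and Y up to the constant Y(-1): taking s - v in place of v - s absorbs
  -- that sign.
  kernelSum : F.Carrier → Carrier
  kernelSum v = sum (λ s → χ (inv B ⊗ Φ) s * χ Y (s F.- v))

  -- Substitute t = 1 - v/s in J(Y, X).
  kernelSum-nonzero : ∀ {v} → ¬ (v F.≈ F.0#) → χ X v * kernelSum v ≈ J₂
  kernelSum-nonzero {v} v≉0 = trans (sym (sum-*ˡ _ _))
    (sum-reindex σ (λ p → F.+-congˡ (F.-‿cong (F.*-congˡ (F.⁻¹-cong p)))) _ (λ t → χ Y t * χ X (F.1# F.- t))
      (λ p → *-cong (χ-cong Y p) (χ-cong X (F.+-congˡ (F.-‿cong p)))) (λ s → term s (s F.≟ F.0#)) (λ t → preimage t (t F.≟ F.1#)))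
    where
    σ : F.Carrier → F.Carrier
    σ s = F.1# F.- v F.* s F.⁻¹
    complement : ∀ s → F.1# F.- σ s F.≈ v F.* s F.⁻¹
    complement s = solveF 1 (λ u → conF (+ 1) ⊟ (conF (+ 1) ⊟ u) ⊜ u) F.refl (v F.* s F.⁻¹)
    term : ∀ s → Dec (s F.≈ F.0#) → χ X v * (χ (inv B ⊗ Φ) s * χ Y (s F.- v)) ≈ χ Y (σ s) * χ X (F.1# F.- σ s)
    term s (yes s≈0) = trans
      (trans (*-congˡ (trans (*-congʳ (χ-zero (inv B ⊗ Φ) s≈0)) (zeroˡ _))) (zeroʳ _))
      (sym (trans (*-congˡ (χ-zero X (F.trans (complement s)
        (F.trans (F.*-congˡ (F.trans (F.⁻¹-cong s≈0) F.0⁻¹≈0)) (F.zeroʳ v))))) (zeroʳ _)))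
    term s (no s≉0) = sym (begin
      χ Y (σ s) * χ X (F.1# F.- σ s)
        ≈⟨ *-cong (trans (χ-cong Y σs) (χ-* Y _ _)) (trans (χ-cong X (complement s)) (χ-* X _ _)) ⟩
      (χ Y (s F.- v) * χ Y (s F.⁻¹)) * (χ X v * χ X (s F.⁻¹))
        ≈⟨ solve 4 (λ y yi x xi → (y :* yi) :* (x :* xi) := x :* ((yi :* xi) :* y)) refl _ _ _ _ ⟩
      χ X v * ((χ Y (s F.⁻¹) * χ X (s F.⁻¹)) * χ Y (s F.- v))
        ≈⟨ *-congˡ (*-congʳ (trans (Y*X (F.inverse-nonzero s≉0)) (*-cong (χ-⁻¹ B s) (φ-⁻¹ s≉0)))) ⟩
      χ X v * (χ (inv B ⊗ Φ) s * χ Y (s F.- v)) ∎)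
      where
      σs : σ s F.≈ (s F.- v) F.* s F.⁻¹
      σs = F.modulo (F.- F.1#) (F.inverseʳ s s≉0)
        (solveF 3 (λ s i v → conF (+ 1) ⊟ v ⊠ i ⊜ (s ⊟ v) ⊠ i ⊞ (⊟ conF (+ 1)) ⊠ (s ⊠ i ⊟ conF (+ 1))) F.refl s (s F.⁻¹) v)
    preimage : ∀ t → Dec (t F.≈ F.1#) → χ Y t * χ X (F.1# F.- t) ≈ 0# ⊎
      Σ F.Carrier λ s → σ s F.≈ t × (∀ {s′} → σ s′ F.≈ t → s′ F.≈ s)
    preimage t (yes t≈1) = inj₁ (trans (*-congˡ (χ-zero X
      (F.trans (F.+-congˡ (F.-‿cong t≈1)) (F.-‿inverseʳ F.1#)))) (zeroʳ _))
    preimage t (no t≉1) = inj₂ (s , σs≈t , unique)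
      where
      u = F.1# F.- t
      u≉0 : ¬ (u F.≈ F.0#)
      u≉0 = F.difference-nonzero (λ 1≈t → t≉1 (F.sym 1≈t))
      s = v F.* u F.⁻¹
      us≈v : u F.* s F.≈ v
      us≈v = F.modulo v (F.inverseʳ u u≉0)
        (solveF 3 (λ u i v → u ⊠ (v ⊠ i) ⊜ v ⊞ v ⊠ (u ⊠ i ⊟ conF (+ 1))) F.refl u (u F.⁻¹) v)
      s≉0 = F.*-nonzero v≉0 (F.inverse-nonzero u≉0)
      σs≈t : σ s F.≈ t
      σs≈t = F.trans (F.+-congˡ (F.-‿cong (F.*-congʳ (F.sym us≈v))))
        (F.modulo (F.- u) (F.inverseʳ s s≉0)
          (solveF 3 (λ t s i → let u = conF (+ 1) ⊟ t in conF (+ 1) ⊟ (u ⊠ s) ⊠ i ⊜ t ⊞ (⊟ u) ⊠ (s ⊠ i ⊟ conF (+ 1)))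
               F.refl t s (s F.⁻¹)))
      unique : ∀ {s′} → σ s′ F.≈ t → s′ F.≈ s
      unique {s′} σs′≈t = F.*-cancelˡ u u≉0 (F.trans us′≈v (F.sym us≈v))
        where
        vi≈u : v F.* s′ F.⁻¹ F.≈ u
        vi≈u = F.trans (F.sym (complement s′)) (F.+-congˡ (F.-‿cong σs′≈t))
        s′≉0 : ¬ (s′ F.≈ F.0#)
        s′≉0 s′≈0 = u≉0 (F.trans (F.sym vi≈u) (F.trans (F.*-congˡ (F.trans (F.⁻¹-cong s′≈0) F.0⁻¹≈0)) (F.zeroʳ v)))
        us′≈v : u F.* s′ F.≈ v
        us′≈v = F.trans (F.*-congʳ (F.sym vi≈u)) (F.modulo v (F.inverseʳ s′ s′≉0)
          (solveF 3 (λ v s i → (v ⊠ i) ⊠ s ⊜ v ⊞ v ⊠ (s ⊠ i ⊟ conF (+ 1))) F.refl v s′ (s′ F.⁻¹)))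

  -- At v ≈ 0 the summand is (B̄φY)(s), which is X̄(s) because YX = Bφ. The vanishing of Σ X makes
  -- the expansion of X̄(v) valid at v ≈ 0 too, so that it can be used under a sum over all v.
  kernelSum-zero : sum (χ X) ≈ 0# → ∀ {v} → v F.≈ F.0# → kernelSum v ≈ 0#
  kernelSum-zero ΣX≈0 {v} v≈0 = trans (sum-cong (λ s → trans
      (*-congˡ (χ-cong Y (F.trans (F.+-congˡ (F.-‿cong v≈0)) (solveF 1 (λ s → s ⊟ conF (+ 0) ⊜ s) F.refl s))))
      (pointwise s (s F.≟ F.0#))))
    (trans (sum-inv X) ΣX≈0)
    where
    pointwise : ∀ s → Dec (s F.≈ F.0#) → χ (inv B ⊗ Φ) s * χ Y s ≈ χ (inv X) s
    pointwise s (yes s≈0) = trans (trans (*-congˡ (χ-zero Y s≈0)) (zeroʳ _)) (sym (χ-zero (inv X) s≈0))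
    pointwise s (no s≉0)  = inverse-unique _ (begin
      χ X s * (χ B s ⁻¹ * φ F K s * χ Y s)
        ≈⟨ solve 4 (λ x i p y → x :* (i :* p :* y) := (y :* x) :* (i :* p)) refl _ _ _ _ ⟩
      (χ Y s * χ X s) * (χ B s ⁻¹ * φ F K s)     ≈⟨ *-congʳ (Y*X s≉0) ⟩
      (χ B s * φ F K s) * (χ B s ⁻¹ * φ F K s)
        ≈⟨ solve 3 (λ b p i → (b :* p) :* (i :* p) := (b :* i) :* (p :* p)) refl _ _ _ ⟩
      (χ B s * χ B s ⁻¹) * (φ F K s * φ F K s)
        ≈⟨ trans (*-cong (χ⁻¹-inverse B s≉0) (φ-squared s≉0)) (*-identityˡ 1#) ⟩
      1# ∎)

  kernelSum-value : sum (χ X) ≈ 0# → ∀ v → χ (inv X) v * J₂ ≈ kernelSum v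
  kernelSum-value ΣX≈0 v with v F.≟ F.0#
  ... | yes v≈0 = trans (trans (*-congʳ (χ-zero (inv X) v≈0)) (zeroˡ _)) (sym (kernelSum-zero ΣX≈0 v≈0))
  ... | no v≉0  = begin
    χ X v ⁻¹ * J₂                      ≈⟨ *-congˡ (kernelSum-nonzero v≉0) ⟨
    χ X v ⁻¹ * (χ X v * kernelSum v)   ≈⟨ solve 3 (λ i x k → i :* (x :* k) := (x :* i) :* k) refl _ _ _ ⟩
    (χ X v * χ X v ⁻¹) * kernelSum v   ≈⟨ trans (*-congʳ (χ⁻¹-inverse X v≉0)) (*-identityˡ _) ⟩
    kernelSum v                        ∎

  4# : F.Carrier
  4# = F.2# F.* F.2#

  -- From the sum over Q, through the conic, to the right-hand sum.

  module Quadratic (w : F.Carrier) where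

    κ p : F.Carrier
    κ = F.1# F.- w
    p = F.1# F.+ w

    -- For w = z² this is -(v - (1+z)²)(v - (1-z)²); its discriminant is 16w.
    Q : F.Carrier → F.Carrier
    Q v = (p F.+ p) F.* v F.- (v F.* v F.+ κ F.* κ)

    Q-cong : ∀ {x y} → x F.≈ y → Q x F.≈ Q y
    Q-cong e = F.+-cong (F.*-congˡ e) (F.-‿cong (F.+-congʳ (F.*-cong e e)))

    conicSum : F.Carrier → Carrier
    conicSum r = sum (λ e → ⟦ (e F.* e) F.≟ (F.- Q r) ⟧ * χ (Φ ⊗ B) (((p F.+ p) F.- (r F.+ r)) F.+ (e F.+ e)))

    quadratic-sum : ¬ (w F.≈ F.0#) → sum (χ X) ≈ 0# → sum (λ v → χ (inv X) v * χ B (Q v)) * J₂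
      ≈ jacobi Φ B * sum (λ r → χ Y (F.- r) * conicSum r)
    quadratic-sum w≉0 ΣX≈0 = begin
      sum (λ v → χ (inv X) v * χ B (Q v)) * J₂
        ≈⟨ sum-*ʳ _ _ ⟨
      sum (λ v → χ (inv X) v * χ B (Q v) * J₂)
        ≈⟨ sum-cong (λ v → trans (solve 3 (λ x b j → x :* b :* j := (x :* j) :* b)
             refl _ _ _) (*-congʳ (kernelSum-value ΣX≈0 v))) ⟩
      sum (λ v → kernelSum v * χ B (Q v))
        ≈⟨ sum-cong (λ v → sym (sum-*ʳ _ _)) ⟩
      sum (λ v → sum (λ s → χ (inv B ⊗ Φ) s * χ Y (s F.- v) * χ B (Q v)))
        ≈⟨ sum-swap _ ⟩
      sum (λ s → sum (λ v → χ (inv B ⊗ Φ) s * χ Y (s F.- v) * χ B (Q v)))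
        -- Substitute v = r + s. Then Y(s - v) becomes Y(-r), and Q(r + s) = βs - s² + Q(r) with β =
        -- 2p - 2r, which is the shape treated by `quadratic-kernel` with n = -Q(r).
        ≈⟨ sum-cong (λ s → trans
             (sym (sum-translate (F.- s) (λ v → χ (inv B ⊗ Φ) s * χ Y (s F.- v) * χ B (Q v))
               (λ e → *-cong (*-congˡ (χ-cong Y (F.+-congˡ (F.-‿cong e)))) (χ-cong B (Q-cong e)))))
             (sum-cong (rewritten s))) ⟩
      sum (λ s → sum (λ r → χ Y (F.- r) * (χ (inv B ⊗ Φ) s * χ B (((p F.+ p) F.- (r F.+ r)) F.* s F.- (s F.* s F.+ F.- Q r)))))
        ≈⟨ sum-swap _ ⟩
      sum (λ r → sum (λ s → χ Y (F.- r) * (χ (inv B ⊗ Φ) s * χ B (((p F.+ p) F.- (r F.+ r)) F.* s F.- (s F.* s F.+ F.- Q r)))))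
        ≈⟨ sum-cong (λ r → trans (sum-*ˡ _ _) (trans (*-congˡ (quadratic-kernel B (F.- Q r) ((p F.+ p) F.- (r F.+ r)) (discriminant r)))
             (solve 3 (λ y j t → y :* (j :* t) := j :* (y :* t)) refl _ _ _))) ⟩
      sum (λ r → jacobi Φ B * (χ Y (F.- r) * conicSum r))
        ≈⟨ sum-*ˡ _ _ ⟩
      jacobi Φ B * sum (λ r → χ Y (F.- r) * conicSum r) ∎
      where
      rewritten : ∀ s r → χ (inv B ⊗ Φ) s * χ Y (s F.- (r F.- F.- s)) * χ B (Q (r F.- F.- s))
        ≈ χ Y (F.- r) * (χ (inv B ⊗ Φ) s * χ B (((p F.+ p) F.- (r F.+ r)) F.* s F.- (s F.* s F.+ F.- Q r)))
      rewritten s r = trans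
        (*-cong
          (*-congˡ (χ-cong Y (solveF 2 (λ s r → s ⊟ (r ⊟ (⊟ s)) ⊜ ⊟ r) F.refl s r)))
          (χ-cong B (solveF 4 (λ p k s r →
            let v = r ⊟ (⊟ s) in (p ⊞ p) ⊠ v ⊟ (v ⊠ v ⊞ k ⊠ k)
              ⊜ ((p ⊞ p) ⊟ (r ⊞ r)) ⊠ s ⊟ (s ⊠ s ⊞ (⊟ ((p ⊞ p) ⊠ r ⊟ (r ⊠ r ⊞ k ⊠ k))))) F.refl p κ s r)))
        (solve 3 (λ i y b → i :* y :* b := y :* (i :* b)) refl _ _ _)
      -- The difference β² - 4n equals 16w for every r, so the degenerate case of `quadratic-kernel`
      -- is excluded for all r at once by w ≉ 0.
      discriminant : ∀ r → ¬ (((p F.+ p) F.- (r F.+ r)) F.* ((p F.+ p) F.- (r F.+ r))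
        F.≈ (F.- Q r F.+ F.- Q r) F.+ (F.- Q r F.+ F.- Q r))
      discriminant r e = F.*-nonzero (F.*-nonzero 4≉0 4≉0) w≉0 (F.modulo F.1# e
        (solveF 2 (λ w r → let one = conF (+ 1); p = one ⊞ w; k = one ⊟ w; t = one ⊞ one
                               b = (p ⊞ p) ⊟ (r ⊞ r); n = ⊟ ((p ⊞ p) ⊠ r ⊟ (r ⊠ r ⊞ k ⊠ k)) in
          ((t ⊠ t) ⊠ (t ⊠ t)) ⊠ w ⊜ conF (+ 0) ⊞ one ⊠ (b ⊠ b ⊟ ((n ⊞ n) ⊞ (n ⊞ n)))) F.refl w r))
        where 4≉0 = F.*-nonzero F.2≉0 F.2≉0

    Line? : ∀ D r → Dec (D F.* r F.≈ F.- ((D F.- F.1#) F.* (D F.- w)))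
    Line? D r = (D F.* r) F.≟ (F.- ((D F.- F.1#) F.* (D F.- w)))

    -- With e = 2D - p + r the conic e² = -Q(r) becomes linear in r.
    conicSum-line : ∀ r → conicSum r ≈ χ B 4# * sum (λ D → ⟦ Line? D r ⟧ * χ (Φ ⊗ B) D)
    conicSum-line r = begin
      conicSum r
        ≈⟨ sum-affine (p F.- r) (λ e → ⟦ Conic? e ⟧ * χ (Φ ⊗ B) (((p F.+ p) F.- (r F.+ r)) F.+ (e F.+ e)))
             (λ {x} {y} e → *-cong
               (⟦⟧-⇔ (Conic? x) (Conic? y) (λ h → F.trans (F.sym (F.*-cong e e)) h) (λ h → F.trans (F.*-cong e e) h))
               (χ-cong (Φ ⊗ B) (F.+-congˡ (F.+-cong e e)))) ⟨
      sum (λ D → ⟦ Conic? (F.2# F.* D F.- (p F.- r)) ⟧ * χ (Φ ⊗ B) (((p F.+ p) F.- (r F.+ r))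
          F.+ ((F.2# F.* D F.- (p F.- r)) F.+ (F.2# F.* D F.- (p F.- r)))))
        ≈⟨ sum-cong (λ D → *-cong (⟦⟧-⇔ (Line? D r) (Conic? (F.2# F.* D F.- (p F.- r))) (to D) (from D)) (χ-cong (Φ ⊗ B) (shift D))) ⟨
      sum (λ D → ⟦ Line? D r ⟧ * χ (Φ ⊗ B) (4# F.* D))
        ≈⟨ sum-cong (λ D → trans (*-congˡ (trans (χ-* (Φ ⊗ B) 4# D) (*-congʳ 4-square)))
             (solve 3 (λ l b d → l :* (b :* d) := b :* (l :* d)) refl _ _ _)) ⟩
      sum (λ D → χ B 4# * (⟦ Line? D r ⟧ * χ (Φ ⊗ B) D))
        ≈⟨ sum-*ˡ _ _ ⟩
      χ B 4# * sum (λ D → ⟦ Line? D r ⟧ * χ (Φ ⊗ B) D) ∎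
      where
      Conic? : ∀ e → Dec (e F.* e F.≈ F.- Q r)
      Conic? e = (e F.* e) F.≟ (F.- Q r)
      4-square : χ (Φ ⊗ B) 4# ≈ χ B 4#
      4-square = trans (*-congʳ (φ-of-square F.2≉0)) (*-identityˡ _)
      shift : ∀ D → 4# F.* D F.≈ ((p F.+ p) F.- (r F.+ r)) F.+ ((F.2# F.* D F.- (p F.- r)) F.+ (F.2# F.* D F.- (p F.- r)))
      shift D = solveF 3 (λ p r D → let t = conF (+ 1) ⊞ conF (+ 1); e = t ⊠ D ⊟ (p ⊟ r) in
        (t ⊠ t) ⊠ D ⊜ ((p ⊞ p) ⊟ (r ⊞ r)) ⊞ (e ⊞ e)) F.refl p r D
      to : ∀ D → D F.* r F.≈ F.- ((D F.- F.1#) F.* (D F.- w)) →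
        (F.2# F.* D F.- (p F.- r)) F.* (F.2# F.* D F.- (p F.- r)) F.≈ F.- Q r
      to D line = F.modulo 4# line (solveF 3 (λ w r D →
        let one = conF (+ 1); t = one ⊞ one; p = one ⊞ w; k = one ⊟ w; e = t ⊠ D ⊟ (p ⊟ r) in
        e ⊠ e ⊜ (⊟ ((p ⊞ p) ⊠ r ⊟ (r ⊠ r ⊞ k ⊠ k))) ⊞ t ⊠ t ⊠ (D ⊠ r ⊟ (⊟ ((D ⊟ one) ⊠ (D ⊟ w))))) F.refl w r D)
      from : ∀ D → (F.2# F.* D F.- (p F.- r)) F.* (F.2# F.* D F.- (p F.- r)) F.≈ F.- Q r →
        D F.* r F.≈ F.- ((D F.- F.1#) F.* (D F.- w))
      from D conic = F.*-cancelˡ 4# (F.*-nonzero F.2≉0 F.2≉0) (F.modulo F.1# conic (solveF 3 (λ w r D →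
        let one = conF (+ 1); t = one ⊞ one; p = one ⊞ w; k = one ⊟ w; e = t ⊠ D ⊟ (p ⊟ r) in
        t ⊠ t ⊠ (D ⊠ r) ⊜ t ⊠ t ⊠ (⊟ ((D ⊟ one) ⊠ (D ⊟ w))) ⊞ one ⊠ (e ⊠ e ⊟ (⊟ ((p ⊞ p) ⊠ r ⊟ (r ⊠ r ⊞ k ⊠ k)))))
             F.refl w r D))

    -- For D ≉ 0 the line equation determines r, with -Dr = (D - 1)(D - w). The weight φB equals YX,
    -- whose factor Y(D) merges with Y(-r) into Y((D - 1)(D - w)) and leaves X(D). At D ≈ 0 both
    -- sides contribute nothing.
    line-sum : sum (λ r → χ Y (F.- r) * conicSum r) ≈ χ B 4# * sum (λ D → χ Y ((D F.- F.1#) F.* (D F.- w)) * χ X D)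
    line-sum = begin
      sum (λ r → χ Y (F.- r) * conicSum r)
        ≈⟨ sum-cong (λ r → trans (*-congˡ (conicSum-line r)) (solve 3 (λ y b s → y :* (b :* s) := b :* (y :* s))
             refl _ _ _)) ⟩
      sum (λ r → χ B 4# * (χ Y (F.- r) * sum (λ D → ⟦ Line? D r ⟧ * χ (Φ ⊗ B) D)))
        ≈⟨ sum-*ˡ _ _ ⟩
      χ B 4# * sum (λ r → χ Y (F.- r) * sum (λ D → ⟦ Line? D r ⟧ * χ (Φ ⊗ B) D))
        ≈⟨ *-congˡ (sum-cong (λ r → trans (sym (sum-*ˡ _ _)) (sum-cong (λ D →
             solve 3 (λ y l d → y :* (l :* d) := l :* (y :* d)) refl _ _ _)))) ⟩
      χ B 4# * sum (λ r → sum (λ D → ⟦ Line? D r ⟧ * (χ Y (F.- r) * χ (Φ ⊗ B) D)))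
        ≈⟨ *-congˡ (trans (sum-swap _) (sum-cong (λ D → at D (D F.≟ F.0#)))) ⟩
      χ B 4# * sum (λ D → χ Y ((D F.- F.1#) F.* (D F.- w)) * χ X D) ∎
      where
      at : ∀ D → Dec (D F.≈ F.0#) → sum (λ r → ⟦ Line? D r ⟧ * (χ Y (F.- r) * χ (Φ ⊗ B) D))
        ≈ χ Y ((D F.- F.1#) F.* (D F.- w)) * χ X D
      at D (yes D≈0) = trans
        (sum-zero (λ r → trans (*-congˡ (trans (*-congˡ (χ-zero (Φ ⊗ B) D≈0)) (zeroʳ _))) (zeroʳ _)))
        (sym (trans (*-congˡ (χ-zero X D≈0)) (zeroʳ _)))
      at D (no D≉0) = begin
        sum (λ r → ⟦ Line? D r ⟧ * (χ Y (F.- r) * χ (Φ ⊗ B) D))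
          ≈⟨ sum-unique (Line? D) r₀ _ is-r₀ (λ r≈r₀ → F.trans (F.*-congˡ r≈r₀) line)
               (λ h → *-congʳ (χ-cong Y (F.-‿cong (is-r₀ h)))) ⟩
        χ Y (F.- r₀) * (φ F K D * χ B D)       ≈⟨ *-congˡ (trans (*-comm _ _) (sym (Y*X D≉0))) ⟩
        χ Y (F.- r₀) * (χ Y D * χ X D)         ≈⟨ solve 3 (λ r y x → r :* (y :* x) := y :* r :* x) refl _ _ _ ⟩
        χ Y D * χ Y (F.- r₀) * χ X D           ≈⟨ *-congʳ (χ-* Y _ _) ⟨
        χ Y (D F.* F.- r₀) * χ X D
          ≈⟨ *-congʳ (χ-cong Y (F.modulo (F.- F.1#) line (solveF 3 (λ D r t → D ⊠ (⊟ r) ⊜ t ⊞ (⊟ conF (+ 1)) ⊠ (D ⊠ r ⊟ (⊟ t)))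
               F.refl D r₀ _))) ⟩
        χ Y ((D F.- F.1#) F.* (D F.- w)) * χ X D ∎
        where
        r₀ = D F.⁻¹ F.* F.- ((D F.- F.1#) F.* (D F.- w))
        line : D F.* r₀ F.≈ F.- ((D F.- F.1#) F.* (D F.- w))
        line = F.trans (F.sym (F.*-assoc _ _ _)) (F.trans (F.*-congʳ (F.inverseʳ D D≉0)) (F.*-identityˡ _))
        is-r₀ : ∀ {r} → D F.* r F.≈ F.- ((D F.- F.1#) F.* (D F.- w)) → r F.≈ r₀
        is-r₀ h = F.*-cancelˡ D D≉0 (F.trans h (F.sym line))

    P₂ : Carrier
    P₂ = sum (λ y → χ Y y * χ X (F.1# F.- y) * χ (inv A) (F.1# F.- w F.* y))

    -- With d = 1 - wy one has σ - 1 = -(1-w)/d and σ - w = -wy(1-w)/d, so the powers of d collect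
    -- into (Y²X)(1/d) = Ā(d). The exceptional values are harmless: D ≈ 1 would be the image of
    -- infinity, and D ≈ 0 is attained both at y ≈ 1 and, by 0⁻¹ ≈ 0, at the pole; the right-hand
    -- summand vanishes at both values.
    möbius-sum : ¬ (w F.≈ F.0#) → ¬ (w F.≈ F.1#) →
      χ Y (κ F.* κ F.* w) * χ X w * P₂ ≈ sum (λ D → χ Y ((D F.- F.1#) F.* (D F.- w)) * χ X D)
    möbius-sum w≉0 w≉1 = trans (sym (sum-*ˡ _ _)) (sum-reindex σ
      (λ e → F.*-cong (F.*-congˡ (F.+-congˡ (F.-‿cong e))) (F.⁻¹-cong (F.+-congˡ (F.-‿cong (F.*-congˡ e))))) _ _
      (λ e → *-cong (χ-cong Y (F.*-cong (F.+-congʳ e) (F.+-congʳ e))) (χ-cong X e))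
      (λ y → term y ((F.1# F.- w F.* y) F.≟ F.0#)) (λ D → preimage D (D F.≟ F.0#) (D F.≟ F.1#)))
      where
      σ : F.Carrier → F.Carrier
      σ y = w F.* (F.1# F.- y) F.* (F.1# F.- w F.* y) F.⁻¹
      σ-zero : ∀ y → F.1# F.- w F.* y F.≈ F.0# → σ y F.≈ F.0#
      σ-zero y d≈0 = F.trans (F.*-congˡ (F.trans (F.⁻¹-cong d≈0) F.0⁻¹≈0)) (F.zeroʳ _)
      term : ∀ y → Dec (F.1# F.- w F.* y F.≈ F.0#) →
        χ Y (κ F.* κ F.* w) * χ X w * (χ Y y * χ X (F.1# F.- y) * χ (inv A) (F.1# F.- w F.* y))
          ≈ χ Y ((σ y F.- F.1#) F.* (σ y F.- w)) * χ X (σ y)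
      term y (yes d≈0) = trans
        (trans (*-congˡ (trans (*-congˡ (χ-zero (inv A) d≈0)) (zeroʳ _))) (zeroʳ _))
        (sym (trans (*-congˡ (χ-zero X (σ-zero y d≈0))) (zeroʳ _)))
      term y (no d≉0) = sym (begin
        χ Y ((σ y F.- F.1#) F.* (σ y F.- w)) * χ X (σ y)
          ≈⟨ *-cong
               (trans (χ-cong Y product) (trans (χ-* Y _ _) (*-cong (χ-* Y _ _) (χ-* Y i i))))
               (trans (χ-* X _ _) (*-congʳ (χ-* X _ _))) ⟩
        (χ Y (κ F.* κ F.* w) * χ Y y) * (χ Y i * χ Y i) * (χ X w * χ X (F.1# F.- y) * χ X i)
          ≈⟨ solve 6 (λ k y i w x j → (k :* y) :* (i :* i) :* (w :* x :* j) := k :* w :* (y :* x :* (i :* (i :* j))))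
               refl _ _ _ _ _ _ ⟩
        χ Y (κ F.* κ F.* w) * χ X w * (χ Y y * χ X (F.1# F.- y) * (χ Y i * (χ Y i * χ X i)))
          ≈⟨ *-congˡ (*-congˡ (trans (Y²*X (F.inverse-nonzero d≉0)) (χ-⁻¹ A _))) ⟩
        χ Y (κ F.* κ F.* w) * χ X w * (χ Y y * χ X (F.1# F.- y) * χ (inv A) (F.1# F.- w F.* y)) ∎)
        where
        i = (F.1# F.- w F.* y) F.⁻¹
        id≈1 = F.inverseʳ _ d≉0
        product : (σ y F.- F.1#) F.* (σ y F.- w) F.≈ κ F.* κ F.* w F.* y F.* (i F.* i)
        product = F.trans
          (F.*-cong
            (F.modulo F.1# id≈1 (solveF 3 (λ w y i → let one = conF (+ 1) in
              w ⊠ (one ⊟ y) ⊠ i ⊟ one ⊜ (w ⊟ one) ⊠ i ⊞ one ⊠ ((one ⊟ w ⊠ y) ⊠ i ⊟ one)) F.refl w y i))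
            (F.modulo w id≈1 (solveF 3 (λ w y i → let one = conF (+ 1) in
              w ⊠ (one ⊟ y) ⊠ i ⊟ w ⊜ w ⊠ y ⊠ (w ⊟ one) ⊠ i ⊞ w ⊠ ((one ⊟ w ⊠ y) ⊠ i ⊟ one)) F.refl w y i)))
          (solveF 3 (λ w y i → let one = conF (+ 1) in
            ((w ⊟ one) ⊠ i) ⊠ (w ⊠ y ⊠ (w ⊟ one) ⊠ i) ⊜ (one ⊟ w) ⊠ (one ⊟ w) ⊠ w ⊠ y ⊠ (i ⊠ i)) F.refl w y i)
      preimage : ∀ D → Dec (D F.≈ F.0#) → Dec (D F.≈ F.1#) → χ Y ((D F.- F.1#) F.* (D F.- w)) * χ X D ≈ 0# ⊎
        Σ F.Carrier λ y → σ y F.≈ D × (∀ {y′} → σ y′ F.≈ D → y′ F.≈ y)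
      preimage D (yes D≈0) _ = inj₁ (trans (*-congˡ (χ-zero X D≈0)) (zeroʳ _))
      preimage D (no _) (yes D≈1) = inj₁ (trans (*-congʳ (χ-zero Y
        (F.trans (F.*-congʳ (F.trans (F.+-congʳ D≈1) (F.-‿inverseʳ F.1#))) (F.zeroˡ _)))) (zeroˡ _))
      preimage D (no D≉0) (no D≉1) = inj₂ (y , σy≈D , unique)
        where
        -- Clearing denominators in σ y ≈ D gives m y ≈ D - w.
        m = w F.* (D F.- F.1#)
        m≉0 = F.*-nonzero w≉0 (F.difference-nonzero D≉1)
        y = m F.⁻¹ F.* (D F.- w)
        my : m F.* y F.≈ D F.- w
        my = F.trans (F.sym (F.*-assoc _ _ _)) (F.trans (F.*-congʳ (F.inverseʳ m m≉0)) (F.*-identityˡ _))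
        d≉0 : ¬ (F.1# F.- w F.* y F.≈ F.0#)
        -- From m y ≈ D - w it follows that (D - 1)(1 - wy) = w - 1, which is nonzero.
        d≉0 d≈0 = F.difference-nonzero w≉1 (F.modulo (D F.- F.1#) d≈0 (F.trans
          (solveF 2 (λ w D → w ⊟ conF (+ 1) ⊜ (D ⊟ conF (+ 1)) ⊟ (D ⊟ w)) F.refl w D)
          (F.trans (F.+-congˡ (F.-‿cong (F.sym my)))
            (solveF 3 (λ w D y → let one = conF (+ 1) in
              (D ⊟ one) ⊟ w ⊠ (D ⊟ one) ⊠ y ⊜ conF (+ 0) ⊞ (D ⊟ one) ⊠ ((one ⊟ w ⊠ y) ⊟ conF (+ 0))) F.refl w D y))))
        σy≈D : σ y F.≈ D
        σy≈D = F.trans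
          (F.*-congʳ (F.modulo F.1# my (solveF 3 (λ w D y → let one = conF (+ 1) in
            w ⊠ (one ⊟ y) ⊜ D ⊠ (one ⊟ w ⊠ y) ⊞ one ⊠ (w ⊠ (D ⊟ one) ⊠ y ⊟ (D ⊟ w))) F.refl w D y)))
          (F.trans (F.*-assoc _ _ _) (F.trans (F.*-congˡ (F.inverseʳ _ d≉0)) (F.*-identityʳ D)))
        unique : ∀ {y′} → σ y′ F.≈ D → y′ F.≈ y
        unique {y′} σy′≈D = F.*-cancelˡ m m≉0 (F.trans my′ (F.sym my))
          where
          d′≉0 : ¬ (F.1# F.- w F.* y′ F.≈ F.0#)
          d′≉0 d′≈0 = D≉0 (F.trans (F.sym σy′≈D) (σ-zero y′ d′≈0))
          Dd′ : w F.* (F.1# F.- y′) F.≈ D F.* (F.1# F.- w F.* y′)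
          Dd′ = F.trans (F.sym (F.trans (F.*-assoc _ _ _) (F.trans (F.*-congˡ (F.inverseˡ _ d′≉0)) (F.*-identityʳ _))))
            (F.*-congʳ σy′≈D)
          my′ : m F.* y′ F.≈ D F.- w
          my′ = F.modulo F.1# Dd′ (solveF 3 (λ w D y → let one = conF (+ 1) in
            w ⊠ (D ⊟ one) ⊠ y ⊜ (D ⊟ w) ⊞ one ⊠ (w ⊠ (one ⊟ y) ⊟ D ⊠ (one ⊟ w ⊠ y))) F.refl w D y′)

-- Specialisation to w = z² and assembly of the constants.

module Evaluation {c ℓ c′ ℓ′} (F : FiniteField c ℓ) (odd : FiniteField.q F % 2 ≡ 1)
  (K : Field c′ ℓ′) (char0 : CharZero K) (A B : Character F K)
  (z : FiniteField.Carrier F) (z≉1 : ¬ (FiniteField._≈_ F z (FiniteField.1# F)))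
  (z≉-1 : ¬ (FiniteField._≈_ F z (FiniteField.-_ F (FiniteField.1# F)))) where
  open Transformation F odd K char0 A B public
  open Field K
  open FieldProperties K
  open IntegerSolver commutativeRing
  open SetoidReasoning setoid
  open Character

  w : F.Carrier
  w = z F.* z

  open Quadratic w

  1+z≉0 : ¬ (F.1# F.+ z F.≈ F.0#)
  1+z≉0 e = z≉-1 (F.modulo F.1# e
    (solveF 1 (λ z → let one = conF (+ 1) in z ⊜ (⊟ one) ⊞ one ⊠ (one ⊞ z ⊟ conF (+ 0))) F.refl z))

  κ≉0 : ¬ (κ F.≈ F.0#)
  κ≉0 e = F.*-nonzero 1+z≉0 (F.difference-nonzero (λ 1≈z → z≉1 (F.sym 1≈z)))
    (F.trans (solveF 1 (λ z → let one = conF (+ 1) in (one ⊞ z) ⊠ (one ⊟ z) ⊜ one ⊟ z ⊠ z) F.refl z) e)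

  w≉1 : ¬ (w F.≈ F.1#)
  w≉1 w≈1 = κ≉0 (F.trans (F.+-congˡ (F.-‿cong w≈1)) (F.-‿inverseʳ F.1#))

  -- This is (1+z)²(1 - λy) for the left-hand argument λ = 4z/(1+z)²; it is unrelated to the
  -- variable D on the conic in `Quadratic`.
  D : F.Carrier → F.Carrier
  D y = (F.1# F.+ z) F.* (F.1# F.+ z) F.- 4# F.* z F.* y

  D-cong : ∀ {x y} → x F.≈ y → D x F.≈ D y
  D-cong e = F.+-congˡ (F.-‿cong (F.*-congˡ e))

  P₁ : Carrier
  P₁ = sum (λ y → χ B y * χ B (F.1# F.- y) * χ (inv A) (D y))

  module Nonzero (z≉0 : ¬ (z F.≈ F.0#)) where

    w≉0 : ¬ (w F.≈ F.0#)
    w≉0 = F.*-nonzero z≉0 z≉0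

    4≉0 : ¬ (4# F.≈ F.0#)
    4≉0 = F.*-nonzero F.2≉0 F.2≉0

    open F using () renaming (_*_ to _*F_)

    -- v = κ²/D(y), using that the roots (1 ± z)² of Q have product κ².
    reciprocal-sum : χ B (4# *F 4# *F w) * P₁
      ≈ χ B (κ *F κ) * χ (inv A) (κ *F κ) * sum (λ v → χ (inv X) v * χ B (Q v))
    reciprocal-sum = trans (sym (sum-*ˡ _ _)) (trans
      (sum-reindex σ (λ e → F.*-congˡ (F.⁻¹-cong (D-cong e))) _ g
        (λ e → *-congˡ (*-cong (χ-cong (inv X) e) (χ-cong B (Q-cong e))))
        (λ y → term y (D y F.≟ F.0#)) (λ v → preimage v (v F.≟ F.0#)))
      (sum-*ˡ _ _))
      where
      g : F.Carrier → Carrier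
      g v = χ B (κ *F κ) * χ (inv A) (κ *F κ) * (χ (inv X) v * χ B (Q v))
      g-zero : ∀ {v} → v F.≈ F.0# → g v ≈ 0#
      g-zero v≈0 = trans (*-congˡ (trans (*-congʳ (χ-zero (inv X) v≈0)) (zeroˡ _))) (zeroʳ _)
      σ : F.Carrier → F.Carrier
      σ y = κ *F κ *F (D y) F.⁻¹
      σ-zero : ∀ y → D y F.≈ F.0# → σ y F.≈ F.0#
      σ-zero y D≈0 = F.trans (F.*-congˡ (F.trans (F.⁻¹-cong D≈0) F.0⁻¹≈0)) (F.zeroʳ _)
      D*σ : ∀ y → ¬ (D y F.≈ F.0#) → D y *F σ y F.≈ κ *F κ
      D*σ y D≉0 = F.modulo (κ *F κ) (F.inverseʳ _ D≉0)
        (solveF 3 (λ d k i → d ⊠ (k ⊠ i) ⊜ k ⊞ k ⊠ (d ⊠ i ⊟ conF (+ 1))) F.refl (D y) (κ *F κ) ((D y) F.⁻¹))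
      term : ∀ y → Dec (D y F.≈ F.0#) →
        χ B (4# *F 4# *F w) * (χ B y * χ B (F.1# F.- y) * χ (inv A) (D y)) ≈ g (σ y)
      term y (yes D≈0) = trans
        (trans (*-congˡ (trans (*-congˡ (χ-zero (inv A) D≈0)) (zeroʳ _))) (zeroʳ _))
        (sym (g-zero (σ-zero y D≈0)))
      term y (no D≉0) = sym (begin
        χ B (κ *F κ) * χ (inv A) (κ *F κ) * (χ (inv X) v * χ B (Q v))
          ≈⟨ solve 4 (λ k i x q → k :* i :* (x :* q) := i :* x :* (k :* q)) refl _ _ _ _ ⟩
        χ (inv A) (κ *F κ) * χ (inv X) v * (χ B (κ *F κ) * χ B (Q v))
          ≈⟨ *-cong
               (*-congʳ (trans (χ-cong (inv A) (F.sym Dv)) (χ-* (inv A) _ _)))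
               (trans (sym (χ-* B _ _)) (trans (χ-cong B (F.sym Q-reciprocal)) (trans (χ-* B _ _) (*-congˡ (χ-* B v v))))) ⟩
        χ (inv A) (D y) * χ (inv A) v * χ (inv X) v * (χ B (4# *F 4# *F w *F (y *F (F.1# F.- y))) * (χ B v * χ B v))
          ≈⟨ solve 5 (λ d i x m b → d :* i :* x :* (m :* (b :* b)) := d :* m :* ((b :* b :* i) :* x)) refl _ _ _ _ _ ⟩
        χ (inv A) (D y) * χ B (4# *F 4# *F w *F (y *F (F.1# F.- y))) * (χ X v * χ (inv X) v)
          ≈⟨ *-cong (*-congˡ (trans (χ-* B _ _) (*-congˡ (χ-* B _ _)))) (χ⁻¹-inverse X v≉0) ⟩
        χ (inv A) (D y) * (χ B (4# *F 4# *F w) * (χ B y * χ B (F.1# F.- y))) * 1#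
          ≈⟨ solve 4 (λ d m y u → d :* (m :* (y :* u)) :* con (+ 1) := m :* (y :* u :* d)) refl _ _ _ _ ⟩
        χ B (4# *F 4# *F w) * (χ B y * χ B (F.1# F.- y) * χ (inv A) (D y)) ∎)
        where
        v = σ y
        Dv = D*σ y D≉0
        v≉0 : ¬ (v F.≈ F.0#)
        v≉0 = F.*-nonzero (F.*-nonzero κ≉0 κ≉0) (F.inverse-nonzero D≉0)
        -- Since the roots of Q have product κ², v²Q(κ²/v) = κ²Q(v), and here κ²/v = D(y). Moreover
        -- Q(D(y)) = 16w y(1 - y), because D(0) and D(1) are the two roots (1 ± z)².
        Q-reciprocal : 4# *F 4# *F w *F (y *F (F.1# F.- y)) *F (v *F v) F.≈ κ *F κ *F Q v
        Q-reciprocal = F.trans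
          (solveF 3 (λ z y v → let one = conF (+ 1); t = one ⊞ one; w = z ⊠ z; p = one ⊞ w; k = one ⊟ w
                                   d = (one ⊞ z) ⊠ (one ⊞ z) ⊟ (t ⊠ t) ⊠ z ⊠ y in
            (t ⊠ t) ⊠ (t ⊠ t) ⊠ w ⊠ (y ⊠ (one ⊟ y)) ⊠ (v ⊠ v)
              ⊜ (p ⊞ p) ⊠ (d ⊠ v) ⊠ v ⊟ ((d ⊠ v) ⊠ (d ⊠ v) ⊞ k ⊠ k ⊠ (v ⊠ v))) F.refl z y v)
          (F.trans
            (F.+-cong (F.*-congʳ (F.*-congˡ Dv)) (F.-‿cong (F.+-congʳ (F.*-cong Dv Dv))))
            (solveF 3 (λ p k v → (p ⊞ p) ⊠ (k ⊠ k) ⊠ v ⊟ (k ⊠ k ⊠ (k ⊠ k) ⊞ k ⊠ k ⊠ (v ⊠ v))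
              ⊜ k ⊠ k ⊠ ((p ⊞ p) ⊠ v ⊟ (v ⊠ v ⊞ k ⊠ k))) F.refl (F.1# F.+ w) κ v))
      preimage : ∀ v → Dec (v F.≈ F.0#) → g v ≈ 0# ⊎
        Σ F.Carrier λ y → σ y F.≈ v × (∀ {y′} → σ y′ F.≈ v → y′ F.≈ y)
      preimage v (yes v≈0) = inj₁ (g-zero v≈0)
      preimage v (no v≉0) = inj₂ (y , σy≈v , unique)
        where
        d y : F.Carrier
        d = κ *F κ *F v F.⁻¹
        y = (4# *F z) F.⁻¹ *F ((F.1# F.+ z) *F (F.1# F.+ z) F.- d)
        4z≉0 : ¬ (4# *F z F.≈ F.0#)
        4z≉0 = F.*-nonzero 4≉0 z≉0
        Dy≈d : D y F.≈ d
        Dy≈d = F.modulo (F.- (s F.- d)) (F.inverseʳ _ 4z≉0)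
          (solveF 4 (λ t i s d → s ⊟ t ⊠ (i ⊠ (s ⊟ d)) ⊜ d ⊞ (⊟ (s ⊟ d)) ⊠ (t ⊠ i ⊟ conF (+ 1)))
               F.refl (4# *F z) ((4# *F z) F.⁻¹) s d)
          where s = (F.1# F.+ z) *F (F.1# F.+ z)
        Dy≉0 : ¬ (D y F.≈ F.0#)
        Dy≉0 e = F.*-nonzero (F.*-nonzero κ≉0 κ≉0) (F.inverse-nonzero v≉0) (F.trans (F.sym Dy≈d) e)
        Dy*v : D y *F v F.≈ κ *F κ
        Dy*v = F.trans (F.*-congʳ Dy≈d) (F.trans (F.*-assoc _ _ _)
          (F.trans (F.*-congˡ (F.inverseˡ v v≉0)) (F.*-identityʳ _)))
        σy≈v : σ y F.≈ v
        σy≈v = F.*-cancelˡ (D y) Dy≉0 (F.trans (D*σ y Dy≉0) (F.sym Dy*v))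
        unique : ∀ {y′} → σ y′ F.≈ v → y′ F.≈ y
        unique {y′} σy′≈v = F.*-cancelˡ (4# *F z) 4z≉0 (F.modulo (F.- F.1#) Dy′≈Dy
          (solveF 4 (λ t s a b → t ⊠ a ⊜ t ⊠ b ⊞ (⊟ conF (+ 1)) ⊠ ((s ⊟ t ⊠ a) ⊟ (s ⊟ t ⊠ b)))
               F.refl (4# *F z) ((F.1# F.+ z) *F (F.1# F.+ z)) y′ y))
          where
          Dy′≉0 : ¬ (D y′ F.≈ F.0#)
          Dy′≉0 e = v≉0 (F.trans (F.sym σy′≈v) (σ-zero y′ e))
          Dy′≈Dy : D y′ F.≈ D y
          Dy′≈Dy = F.*-cancelˡ v v≉0 (F.trans (F.*-comm _ _) (F.trans (F.*-congˡ (F.sym σy′≈v))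
            (F.trans (D*σ y′ Dy′≉0) (F.trans (F.sym Dy*v) (F.*-comm _ _)))))

    -- The values of φ drop out because κ² and w = z² are nonzero squares; on w the relation YX = Bφ
    -- leaves only B.
    möbius-constant : χ Y (κ *F κ *F w) * χ X w ≈ χ A (κ *F κ) * χ B (κ *F κ) ⁻¹ * χ B w
    möbius-constant = begin
      χ Y (κ *F κ *F w) * χ X w
        ≈⟨ trans (*-congʳ (χ-* Y _ _)) (*-assoc _ _ _) ⟩
      χ Y (κ *F κ) * (χ Y w * χ X w)
        ≈⟨ *-cong (*-congʳ (*-congˡ (φ-of-square κ≉0))) (trans (Y*X w≉0) (*-congˡ (φ-of-square z≉0))) ⟩
      χ A (κ *F κ) * 1# * χ B (κ *F κ) ⁻¹ * (χ B w * 1#)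
        ≈⟨ solve 3 (λ a b w → a :* con (+ 1) :* b :* (w :* con (+ 1)) := a :* b :* w) refl _ _ _ ⟩
      χ A (κ *F κ) * χ B (κ *F κ) ⁻¹ * χ B w ∎

    -- The factor B(16w) produced by `reciprocal-sum` reappears on the other side as B(4)B(4)B(w):
    -- one B(4) from the parametrisation of the conic, one from trading J(φ,B) for J(B,B), and B(w)
    -- from `möbius-constant`. All values at κ² cancel.
    P₁*J₂≈P₂*J₁ : sum (χ X) ≈ 0# → sum (χ B) ≈ 0# → P₁ * J₂ ≈ P₂ * jacobi B B
    P₁*J₂≈P₂*J₁ ΣX≈0 ΣB≈0 = *-cancelˡ (χ B (4# *F 4# *F w)) (χ-nonzero B (F.*-nonzero (F.*-nonzero 4≉0 4≉0) w≉0)) (begin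
      χ B (4# *F 4# *F w) * (P₁ * J₂)
        ≈⟨ trans (sym (*-assoc _ _ _)) (*-congʳ reciprocal-sum) ⟩
      χ B κ² * χ (inv A) κ² * S * J₂
        ≈⟨ trans (*-assoc _ _ _) (*-congˡ (trans (quadratic-sum w≉0 ΣX≈0)
             (*-congˡ (trans line-sum (*-congˡ (trans (sym (möbius-sum w≉0 w≉1)) (*-congʳ möbius-constant))))))) ⟩
      χ B κ² * χ A κ² ⁻¹ * (jacobi Φ B * (χ B 4# * (χ A κ² * χ B κ² ⁻¹ * χ B w * P₂)))
        ≈⟨ solve 8 (λ b a′ j f a b′ w p → b :* a′ :* (j :* (f :* (a :* b′ :* w :* p))) := (b :* b′) :* (a :* a′) :* (j :* (f :* (w :* p))))
             refl _ _ _ _ _ _ _ _ ⟩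
      (χ B κ² * χ B κ² ⁻¹) * (χ A κ² * χ A κ² ⁻¹) * (jacobi Φ B * (χ B 4# * (χ B w * P₂)))
        ≈⟨ *-cong (trans (*-cong (χ⁻¹-inverse B κ²≉0) (χ⁻¹-inverse A κ²≉0)) (*-identityˡ 1#)) (*-congʳ (sym (jacobi-diagonal B ΣB≈0))) ⟩
      1# * (χ B 4# * jacobi B B * (χ B 4# * (χ B w * P₂)))
        ≈⟨ solve 4 (λ f j w p → con (+ 1) :* (f :* j :* (f :* (w :* p))) := f :* f :* w :* (p :* j)) refl _ _ _ _ ⟩
      χ B 4# * χ B 4# * χ B w * (P₂ * jacobi B B)
        ≈⟨ *-congʳ (trans (χ-* B _ _) (*-congʳ (χ-* B _ _))) ⟨
      χ B (4# *F 4# *F w) * (P₂ * jacobi B B) ∎)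
      where
      κ² = κ *F κ
      κ²≉0 = F.*-nonzero κ≉0 κ≉0
      S = sum (λ v → χ (inv X) v * χ B (Q v))

  -- At z ≈ 0 every factor Ā is Ā(1) = 1, so `P₁` and `P₂` are the Jacobi sums J(B,B) and J(Y,X)
  -- themselves.
  P₁*J₂≈P₂*J₁-zero : z F.≈ F.0# → P₁ * J₂ ≈ P₂ * jacobi B B
  P₁*J₂≈P₂*J₁-zero z≈0 = trans (*-cong
      (sum-cong (λ y → trans (*-congˡ (trans (χ-cong (inv A) (D≈1 y)) (χ-1 (inv A)))) (*-identityʳ _)))
      (sum-cong (λ y → sym (trans (*-congˡ (trans (χ-cong (inv A) (1-wy≈1 y)) (χ-1 (inv A)))) (*-identityʳ _)))))
    (*-comm _ _)
    where
    D≈1 : ∀ y → D y F.≈ F.1#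
    D≈1 y = F.trans (F.+-cong (F.*-cong (F.+-congˡ z≈0) (F.+-congˡ z≈0)) (F.-‿cong (F.*-congʳ (F.*-congˡ z≈0))))
      (solveF 2 (λ t y → let one = conF (+ 1); nil = conF (+ 0) in (one ⊞ nil) ⊠ (one ⊞ nil) ⊟ t ⊠ nil ⊠ y ⊜ one)
           F.refl 4# y)
    1-wy≈1 : ∀ y → F.1# F.- w F.* y F.≈ F.1#
    1-wy≈1 y = F.trans (F.+-congˡ (F.-‿cong (F.*-congʳ (F.*-cong z≈0 z≈0))))
      (solveF 1 (λ y → let one = conF (+ 1); nil = conF (+ 0) in one ⊟ nil ⊠ nil ⊠ y ⊜ one) F.refl y)

  P₁*J₂≈P₂*J₁ : sum (χ X) ≈ 0# → sum (χ B) ≈ 0# → P₁ * J₂ ≈ P₂ * jacobi B B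
  P₁*J₂≈P₂*J₁ ΣX≈0 ΣB≈0 with z F.≟ F.0#
  ... | yes z≈0 = P₁*J₂≈P₂*J₁-zero z≈0
  ... | no z≉0  = Nonzero.P₁*J₂≈P₂*J₁ z≉0 ΣX≈0 ΣB≈0

  B-conj : ∀ x → χ (inv B ⊗ (B ⊗ B)) x ≈ χ B x
  B-conj x with x F.≟ F.0#
  ... | yes x≈0 = trans (χ-zero (inv B ⊗ (B ⊗ B)) x≈0) (sym (χ-zero B x≈0))
  ... | no x≉0  = trans (solve 2 (λ i b → i :* (b :* b) := (b :* i) :* b) refl _ _)
    (trans (*-congʳ (χ⁻¹-inverse B x≉0)) (*-identityˡ _))

  λz : F.Carrier
  λz = (F.natCast 4 F.* z) F.* ((F.1# F.+ z) F.* (F.1# F.+ z)) F.⁻¹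

  -- Since 1 - λy = D(y)/(1+z)², the denominator contributes Ā((1+z)⁻²) = A²(1+z), the prefactor of
  -- the theorem.
  P₂₁-left : P₂₁ F K (χ A) (χ B) (χ (B ⊗ B)) λz ≈ χ (A ⊗ A) (F.1# F.+ z) * P₁
  P₂₁-left = trans (sum-cong (λ y → begin
      χ B y * χ (inv B ⊗ (B ⊗ B)) (F.1# F.- y) * χ (inv A) (F.1# F.- λz F.* y)
        ≈⟨ *-cong (*-congˡ (B-conj _)) (rescale y) ⟩
      χ B y * χ B (F.1# F.- y) * (χ (A ⊗ A) (F.1# F.+ z) * χ (inv A) (D y))
        ≈⟨ solve 4 (λ b c s d → b :* c :* (s :* d) := s :* (b :* c :* d)) refl _ _ _ _ ⟩
      χ (A ⊗ A) (F.1# F.+ z) * (χ B y * χ B (F.1# F.- y) * χ (inv A) (D y)) ∎))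
    (sum-*ˡ _ _)
    where
    s = (F.1# F.+ z) F.* (F.1# F.+ z)
    s≉0 : ¬ (s F.≈ F.0#)
    s≉0 = F.*-nonzero 1+z≉0 1+z≉0
    D≈ : ∀ y → D y F.≈ s F.* (F.1# F.- λz F.* y)
    -- The solver needs `natCast 4` in its unfolded form, a nested sum ending in 0, to identify it
    -- with the product 2 · 2 that `D` uses.
    D≈ y = F.modulo (4# F.* z F.* y) (F.inverseʳ s s≉0) (solveF 3 (λ z y i →
      let one = conF (+ 1); nil = conF (+ 0); t = one ⊞ one; s = (one ⊞ z) ⊠ (one ⊞ z) in
      s ⊟ (t ⊠ t) ⊠ z ⊠ y ⊜ s ⊠ (one ⊟ (one ⊞ (one ⊞ (one ⊞ (one ⊞ nil)))) ⊠ z ⊠ i ⊠ y) ⊞ (t ⊠ t) ⊠ z ⊠ y ⊠ (s ⊠ i ⊟ one))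
      F.refl z y (s F.⁻¹))
    rescale : ∀ y → χ (inv A) (F.1# F.- λz F.* y) ≈ χ (A ⊗ A) (F.1# F.+ z) * χ (inv A) (D y)
    rescale y = sym (begin
      χ (A ⊗ A) (F.1# F.+ z) * χ (inv A) (D y)
        ≈⟨ *-cong (sym (χ-* A _ _)) (trans (χ-cong (inv A) (D≈ y)) (χ-* (inv A) _ _)) ⟩
      χ A s * (χ A s ⁻¹ * χ (inv A) (F.1# F.- λz F.* y))
        ≈⟨ trans (sym (*-assoc _ _ _)) (trans (*-congʳ (χ⁻¹-inverse A s≉0)) (*-identityˡ _)) ⟩
      χ (inv A) (F.1# F.- λz F.* y) ∎)

  quadratic-transformation : Nontrivial F K (χ B) → Nontrivial F K (χ X) → Nontrivial F K (χ Y) →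
    F₂₁ F K (χ A) (χ B) (χ (B ⊗ B)) λz
      ≈ χ (A ⊗ A) (F.1# F.+ z) * F₂₁ F K (χ A) (χ Y) (χ (B ⊗ Φ)) w
  quadratic-transformation B-nontrivial X-nontrivial Y-nontrivial = begin
    P₂₁ F K (χ A) (χ B) (χ (B ⊗ B)) λz * J F K (χ B) (χ (inv B ⊗ (B ⊗ B))) ⁻¹
      ≈⟨ *-cong P₂₁-left (⁻¹-cong (sum-cong (λ t → *-congˡ (B-conj _)))) ⟩
    α * P₁ * jacobi B B ⁻¹
      ≈⟨ *-congʳ (*-congˡ (trans (*-congˡ (inverseʳ J₂ J₂≉0)) (*-identityʳ P₁))) ⟨
    α * (P₁ * (J₂ * J₂ ⁻¹)) * jacobi B B ⁻¹
      ≈⟨ solve 5 (λ a p j j′ k′ → a :* (p :* (j :* j′)) :* k′ := a :* ((p :* j) :* (k′ :* j′)))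
           refl α P₁ J₂ (J₂ ⁻¹) (jacobi B B ⁻¹) ⟩
    α * ((P₁ * J₂) * (jacobi B B ⁻¹ * J₂ ⁻¹))
      ≈⟨ *-congˡ (*-congʳ (P₁*J₂≈P₂*J₁ ΣX≈0 ΣB≈0)) ⟩
    α * ((P₂ * jacobi B B) * (jacobi B B ⁻¹ * J₂ ⁻¹))
      ≈⟨ solve 5 (λ a p k k′ j′ → a :* ((p :* k) :* (k′ :* j′)) := a :* (p :* (k :* k′) :* j′))
           refl α P₂ (jacobi B B) (jacobi B B ⁻¹) (J₂ ⁻¹) ⟩
    α * (P₂ * (jacobi B B * jacobi B B ⁻¹) * J₂ ⁻¹)
      ≈⟨ *-congˡ (*-congʳ (trans (*-congˡ (inverseʳ _ (jacobi-nonzero B B ΣB≈0 ΣB≈0))) (*-identityʳ P₂))) ⟩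
    α * (P₂ * J₂ ⁻¹)
      ≈⟨ *-congˡ (*-cong (sum-cong (λ y → *-congʳ (*-congˡ (X-conj _)))) (⁻¹-cong (sum-cong (λ t → *-congˡ (X-conj _))))) ⟨
    α * F₂₁ F K (χ A) (χ Y) (χ (B ⊗ Φ)) w ∎
    where
    α = χ (A ⊗ A) (F.1# F.+ z)
    ΣB≈0 = sum-nontrivial B B-nontrivial
    ΣX≈0 = sum-nontrivial X X-nontrivial
    ΣY≈0 = sum-nontrivial Y Y-nontrivial
    J₂≉0 : ¬ (J₂ ≈ 0#)
    J₂≉0 = jacobi-nonzero Y X ΣY≈0 ΣX≈0

theorem9p4 : {c ℓ c′ ℓ′ : Level} (F : FiniteField c ℓ) → FiniteField.q F % 2 ≡ 1 →
    (K : Field c′ ℓ′) → CharZero K →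
    (A B : Character F K) →
    let a = Character.χ A
        b = Character.χ B
        four = FiniteField.natCast F 4
        _*_ = FiniteField._*_ F
        _+_ = FiniteField._+_ F
        1F = FiniteField.1# F
    in Nontrivial F K b →
       Nontrivial F K (_·_ F K (_·_ F K b b) (conj F K a)) →
       Nontrivial F K (_·_ F K (_·_ F K a (conj F K b)) (φ F K)) →
       (z : FiniteField.Carrier F) →
       ¬ (FiniteField._≈_ F z 1F) →
       ¬ (FiniteField._≈_ F z (FiniteField.-_ F 1F)) →
       Field._≈_ K
         (F₂₁ F K a b (_·_ F K b b)
            ((four * z) * FiniteField._⁻¹ F ((1F + z) * (1F + z))))
         (Field._*_ K (_·_ F K a a (1F + z))
            (F₂₁ F K a (_·_ F K (_·_ F K a (φ F K)) (conj F K b)) (_·_ F K b (φ F K)) (z * z)))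
theorem9p4 F odd K char0 A B B-nontrivial X-nontrivial Y-nontrivial z z≉1 z≉-1 =
  quadratic-transformation B-nontrivial X-nontrivial (λ trivial → Y-nontrivial (λ x → trans (reorder _ _ _) (trivial x)))
  where
  open Field K
  open IntegerSolver commutativeRing
  open Evaluation F odd K char0 A B z z≉1 z≉-1
  reorder : ∀ x y z → x * y * z ≈ x * z * y
  reorder = solve 3 (λ x y z → x :* y :* z := x :* z :* y) refl
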